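{- Let $K_1$ and $K_2$ be disjoint sets of Boolean connectives, neither of which is functionally complete, such that $K=K_1\cup K_2$ is functionally complete. Then the disjoint fibring of $\mathcal{B}_{K_1}$ and $\mathcal{B}_{K_2}$ is classical, i.e. $\mathcal{B}_{K_1}\bullet\mathcal{B}_{K_2}=\mathcal{B}_{K}$, if and only if for some $i\in\{1,2\}$ and $j=3-i$ we have $$\mathcal{C}^{K_i}\in\{\mathbb{D},\mathbb{T}_0^\infty\}\cup\{\mathbb{T}_0^k : k\in\mathbb{N}\}\quad\text{and}\quad \mathcal{C}^{K_j}=\mathbb{UP}_1.$$
   Context: Fix a denumerable set $P=\{p_1,p_2,\dots\}$ of sentential variables. A signature $\Sigma$ is a set of connective symbols, each with an arity in $\{0,1,2,\dots\}$; $L_\Sigma(P)$ is the set of formulas freely generated by $P$ over $\Sigma$. A logic over $L_\Sigma(P)$ is a pair $\langle L_\Sigma(P),\vdash\rangle$ with $\vdash\,\subseteq \mathcal{P}(L_\Sigma(P))\times L_\Sigma(P)$ satisfying: (R) $\Gamma\cup\{C\}\vdash C$; (M) $\Gamma\vdash C$ implies $\Gamma\cup\Delta\vdash C$; (T) if $\Gamma\vdash D$ for all $D\in\Delta$ and $\Gamma\cup\Delta\vdash C$, then $\Gamma\vdash C$; (SI) $\Gamma\vdash C$ implies $\Gamma^\sigma\vdash C^\sigma$ for every substitution $\sigma:P\to L_\Sigma(P)$. The fibring $\mathcal{L}_a\bullet\mathcal{L}_b$ of logics $\mathcal{L}_a=\langle L_{\Sigma_a}(P),\vdash_a\rangle$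 and $\mathcal{L}_b=\langle L_{\Sigma_b}(P),\vdash_b\rangle$ is the logic over $L_{\Sigma_a\cup\Sigma_b}(P)$ whose consequence relation is the smallest one (satisfying R, M, T, SI over that language) that includes both $\vdash_a$ and $\vdash_b$. It is called disjoint if $\Sigma_a\cap\Sigma_b=\varnothing$. A Boolean connective is a connective symbol of some arity $k\geq 0$ together with a fixed interpretation $\{0,1\}^k\to\{0,1\}$. For a set $K$ of Boolean connectives, $\mathcal{B}_K=\langle L_K(P),\vdash_K\rangle$ is the two-valued logic given by: $\Gamma\vdash_K C$ iff every valuation $v:L_K(P)\to\{0,1\}$ respecting the interpretations of the connectives and satisfying $v(G)=1$ for all $G\in\Gamma$ also satisfies $v(C)=1$. For a set $K$ of Boolean connectives, $\mathcal{C}^K$ is the clone of all operations on $\{0,1\}$ that are interpretations of term functions given by formulas of $L_K(P)$ (operations taken of positive arity, a nullary connective contributing the corresponding constant functions). $K$ is functionally complete if $\mathcal{C}^K$ contains all operations on $\{0,1\}$. The named clones are: $\mathbb{UP}_1=\mathcal{C}^{\{\top\}}$ (described as the clone formed by the Boolean top-like connectives, i.e. those whose value is constantly $1$), $\mathbb{D}=\mathcal{C}^{\{T^3_2,\neg\}}$, $\mathbb{T}_0^\infty=\mathcal{C}^{\{\not\to\}}$, and $\mathbb{T}_0^k=\mathcal{C}^{\{T^{k+1}_k,\,\not\to\}}$ for $k\in\mathbb{N}$. Here $\top$ is the constant $1$, $\neg$ is Boolean negation, $\not\to$ is the binary function with $\not\to(x,y)=1$ iff $x=1$ and $y=0$,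 and $T^n_k$ is the $n$-ary threshold function with $T^n_k(x_1,\dots,x_n)=1$ iff at least $k$ of the $x_i$ equal $1$.
   Formalization: The condition C^{K_j} = UP_1 is supplemented by requiring every connective in K_j to be top-like (constantly 1); with K_1={↛}, K_2={⊤, a unary identity connective} the literal claim fails. -}

module Defs where

open import Level using (Level; 0ℓ; _⊔_) renaming (suc to lsuc)
open import Data.Bool.Base using (Bool; true; false; not; _∧_)
open import Data.Fin.Base using (Fin)
open import Data.Nat.Base using (ℕ; suc; _≤ᵇ_)
open import Data.Product.Base using (∃; _×_; _,_; proj₁; proj₂)
open import Data.Sum.Base using (_⊎_; inj₁; inj₂; [_,_])
open import Data.Vec.Base using (Vec; []; _∷_; lookup; map; countᵇ)
open import Function.Base using (id; _∘_)
open import Function.Bundles using (_⇔_)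
open import Relation.Binary.PropositionalEquality
  using (_≡_; _≗_; refl; trans; cong)
open import Relation.Unary using (Pred; _∈_; _⊆_; _∪_; _≐_)

private
  variable
    a b ℓ ℓ₁ ℓ₂ ℓ₃ : Level

------------------------------------------------------------------------
-- Signatures and formulas

record Signature : Set₁ where
  field
    Symbol : Set
    arity  : Symbol → ℕ

open Signature public

-- Union of disjoint signatures.
_⊕_ : Signature → Signature → Signature
Σ₁ ⊕ Σ₂ = record
  { Symbol = Symbol Σ₁ ⊎ Symbol Σ₂
  ; arity  = [ arity Σ₁ , arity Σ₂ ]
  }

data Formula (Σ : Signature) (V : Set a) : Set a where
  var : V → Formula Σ V
  con : (c : Symbol Σ) → Vec (Formula Σ V) (arity Σ c) → Formula Σ V

-- L Σ is L_Σ(P), the variable p_{i+1} being var i.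
L : Signature → Set
L Σ = Formula Σ ℕ

-- The unique homomorphism from the free algebra extending a map on variables.
module _ {Σ : Signature} {V : Set a} {B : Set b}
         (alg : (c : Symbol Σ) → Vec B (arity Σ c) → B) (ρ : V → B) where

  extend  : Formula Σ V → B
  extends : ∀ {n} → Vec (Formula Σ V) n → Vec B n

  extend (var x)    = ρ x
  extend (con c ts) = alg c (extends ts)

  extends []       = []
  extends (t ∷ ts) = extend t ∷ extends ts

substitute : ∀ {Σ} → (ℕ → L Σ) → L Σ → L Σ
substitute σ = extend con σ

injectˡ : ∀ {Σ₁ Σ₂} → L Σ₁ → L (Σ₁ ⊕ Σ₂)
injectˡ = extend (λ c → con (inj₁ c)) var

injectʳ : ∀ {Σ₁ Σ₂} → L Σ₂ → L (Σ₁ ⊕ Σ₂)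
injectʳ = extend (λ c → con (inj₂ c)) var

------------------------------------------------------------------------
-- Logics

image : {A B : Set} → (A → B) → Pred A 0ℓ → Pred B 0ℓ
image f Γ y = ∃ λ x → x ∈ Γ × y ≡ f x

-- Sets of formulas are predicates, whose extensional equality is not _≡_;
-- (R) and (M) are therefore phrased by membership and inclusion instead of
-- by sets of the syntactic form Γ ∪ {C} and Γ ∪ Δ.
record Logic (Σ : Signature) (ℓ : Level) : Set (lsuc ℓ) where
  infix 4 _⊢_
  field
    _⊢_ : Pred (L Σ) 0ℓ → L Σ → Set ℓ
    R   : ∀ {Γ C} → C ∈ Γ → Γ ⊢ C
    M   : ∀ {Γ Δ C} → Γ ⊆ Δ → Γ ⊢ C → Δ ⊢ C
    T   : ∀ {Γ Δ C} → (∀ {D} → D ∈ Δ → Γ ⊢ D) → (Γ ∪ Δ) ⊢ C → Γ ⊢ C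
    SI  : ∀ {Γ C} (σ : ℕ → L Σ) → Γ ⊢ C →
          image (substitute σ) Γ ⊢ substitute σ C

-- Equality of logics over the same language, i.e. of consequence relations.
infix 4 _≈_
_≈_ : ∀ {Σ} → Logic Σ ℓ₁ → Logic Σ ℓ₂ → Set (lsuc 0ℓ ⊔ ℓ₁ ⊔ ℓ₂)
𝓛 ≈ 𝓜 = ∀ Γ C → Logic._⊢_ 𝓛 Γ C ⇔ Logic._⊢_ 𝓜 Γ C

------------------------------------------------------------------------
-- Disjoint fibring

module _ {Σ₁ Σ₂ : Signature} (𝓛₁ : Logic Σ₁ ℓ₁) (𝓛₂ : Logic Σ₂ ℓ₂) where

  private
    module 𝓛₁ = Logic 𝓛₁
    module 𝓛₂ = Logic 𝓛₂

  data Fibred : Pred (L (Σ₁ ⊕ Σ₂)) 0ℓ → L (Σ₁ ⊕ Σ₂) →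
                Set (lsuc 0ℓ ⊔ ℓ₁ ⊔ ℓ₂) where
    inclˡ : ∀ {Γ C} → Γ 𝓛₁.⊢ C → Fibred (image injectˡ Γ) (injectˡ C)
    inclʳ : ∀ {Γ C} → Γ 𝓛₂.⊢ C → Fibred (image injectʳ Γ) (injectʳ C)
    R     : ∀ {Γ C} → C ∈ Γ → Fibred Γ C
    M     : ∀ {Γ Δ C} → Γ ⊆ Δ → Fibred Γ C → Fibred Δ C
    T     : ∀ {Γ Δ C} → (∀ {D} → D ∈ Δ → Fibred Γ D) →
            Fibred (Γ ∪ Δ) C → Fibred Γ C
    SI    : ∀ {Γ C} (σ : ℕ → L (Σ₁ ⊕ Σ₂)) → Fibred Γ C →
            Fibred (image (substitute σ) Γ) (substitute σ C)

  infixl 6 _•_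
  _•_ : Logic (Σ₁ ⊕ Σ₂) (lsuc 0ℓ ⊔ ℓ₁ ⊔ ℓ₂)
  _•_ = record { _⊢_ = Fibred ; R = R ; M = M ; T = T ; SI = SI }

  •-least : (𝓜 : Logic (Σ₁ ⊕ Σ₂) ℓ₃) → let open Logic 𝓜 in
            (∀ {Γ C} → Γ 𝓛₁.⊢ C → image injectˡ Γ ⊢ injectˡ C) →
            (∀ {Γ C} → Γ 𝓛₂.⊢ C → image injectʳ Γ ⊢ injectʳ C) →
            ∀ {Γ C} → Fibred Γ C → Γ ⊢ C
  •-least 𝓜 incl₁ incl₂ = least
    where
    module 𝓜 = Logic 𝓜
    least : ∀ {Γ C} → Fibred Γ C → Γ 𝓜.⊢ C
    least (inclˡ d) = incl₁ d
    least (inclʳ d) = incl₂ d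
    least (R C∈Γ)   = 𝓜.R C∈Γ
    least (M Γ⊆Δ d) = 𝓜.M Γ⊆Δ (least d)
    least (T ds d)  = 𝓜.T (λ D∈Δ → least (ds D∈Δ)) (least d)
    least (SI σ d)  = 𝓜.SI σ (least d)

------------------------------------------------------------------------
-- Sets of Boolean connectives and their two-valued logics

record Connectives : Set₁ where
  field
    signature : Signature
    ⟦_⟧       : (c : Symbol signature) → Vec Bool (arity signature c) → Bool

open Connectives public using (signature)

-- Union of disjoint sets of Boolean connectives.
_⊎ᶜ_ : Connectives → Connectives → Connectives
K₁ ⊎ᶜ K₂ = record
  { signature = signature K₁ ⊕ signature K₂
  ; ⟦_⟧       = λ { (inj₁ c) → Connectives.⟦ K₁ ⟧ c
                  ; (inj₂ c) → Connectives.⟦ K₂ ⟧ c }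
  }

module _ (K : Connectives) where

  open Connectives K using (⟦_⟧)

  private
    Σ = signature K

  IsValuation : (L Σ → Bool) → Set
  IsValuation v = ∀ c ts → v (con c ts) ≡ ⟦ c ⟧ (map v ts)

  Entails : Pred (L Σ) 0ℓ → L Σ → Set
  Entails Γ C = ∀ v → IsValuation v →
                (∀ {G} → G ∈ Γ → v G ≡ true) → v C ≡ true

  private
    valuation-∘ : ∀ {v} σ → IsValuation v → IsValuation (v ∘ substitute σ)
    valuation-∘ {v} σ val c ts =
      trans (val c (extends con σ ts)) (cong ⟦ c ⟧ (map-∘ ts))
      where
      map-∘ : ∀ {n} (us : Vec (L Σ) n) →
              map v (extends con σ us) ≡ map (v ∘ substitute σ) us
      map-∘ []       = refl
      map-∘ (u ∷ us) = cong (v (substitute σ u) ∷_) (map-∘ us)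

  𝓑 : Logic Σ 0ℓ
  𝓑 = record
    { _⊢_ = Entails
    ; R   = λ C∈Γ v _ vΓ → vΓ C∈Γ
    ; M   = λ Γ⊆Δ d v val vΔ → d v val (λ G∈Γ → vΔ (Γ⊆Δ G∈Γ))
    ; T   = λ ds d v val vΓ →
              d v val [ vΓ , (λ D∈Δ → ds D∈Δ v val vΓ) ]
    ; SI  = λ σ d v val vΓσ →
              d (v ∘ substitute σ) (valuation-∘ σ val)
                (λ {G} G∈Γ → vΓσ (G , G∈Γ , refl))
    }

------------------------------------------------------------------------
-- Clones

-- Operations on {0,1} of positive arity: (n , f) has arity suc n.
Operation : Set
Operation = ∃ λ n → Vec Bool (suc n) → Bool

-- The k-ary term functions are those of the formulas in p₁, …, p_k.
termFunction : ∀ (K : Connectives) {n} →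
               Formula (signature K) (Fin n) → Vec Bool n → Bool
termFunction K φ xs = extend (Connectives.⟦_⟧ K) (lookup xs) φ

𝓒 : Connectives → Pred Operation 0ℓ
𝓒 K (n , f) = ∃ λ (φ : Formula (signature K) (Fin (suc n))) →
              termFunction K φ ≗ f

FunctionallyComplete : Connectives → Set
FunctionallyComplete K = ∀ f → f ∈ 𝓒 K

TopLike : (K : Connectives) → Symbol (signature K) → Set
TopLike K c = ∀ xs → Connectives.⟦ K ⟧ c xs ≡ true

------------------------------------------------------------------------
-- The named clones

threshold : ∀ (n k : ℕ) → Vec Bool n → Bool
threshold n k xs = k ≤ᵇ countᵇ id xs

nonimplies : Vec Bool 2 → Bool
nonimplies (x ∷ y ∷ []) = x ∧ not y

negation : Vec Bool 1 → Bool
negation (x ∷ []) = not x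

-- The set of connectives with one symbol for each listed operation.
⟨_⟩ : ∀ {m} → Vec (∃ λ k → Vec Bool k → Bool) m → Connectives
⟨ fs ⟩ = record
  { signature = record { Symbol = Fin _ ; arity = λ c → proj₁ (lookup fs c) }
  ; ⟦_⟧       = λ c → proj₂ (lookup fs c)
  }

𝕌ℙ₁ 𝔻 𝕋₀∞ : Pred Operation 0ℓ
𝕌ℙ₁ = 𝓒 ⟨ (0 , λ _ → true) ∷ [] ⟩
𝔻   = 𝓒 ⟨ (3 , threshold 3 2) ∷ (1 , negation) ∷ [] ⟩
𝕋₀∞ = 𝓒 ⟨ (2 , nonimplies) ∷ [] ⟩

𝕋₀ : ℕ → Pred Operation 0ℓ
𝕋₀ k = 𝓒 ⟨ (suc k , threshold (suc k) k) ∷ (2 , nonimplies) ∷ [] ⟩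

-- 𝓒 K ∈ {𝔻 , 𝕋₀∞} ∪ {𝕋₀ k : k ∈ ℕ}
CloneListed : Connectives → Set
CloneListed K = 𝓒 K ≐ 𝔻 ⊎ 𝓒 K ≐ 𝕋₀∞ ⊎ (∃ λ k → 𝓒 K ≐ 𝕋₀ k)

-- 𝓒 K is 𝕌ℙ₁ as the clone formed by top-like connectives.  The equality of
-- clones alone would not see connectives of K interpreted as projections,
-- because bare variables already put all projections into every clone.
-- Such connectives do matter for fibring: if K₁ = {↛} and K₂ = {⊤ , id}
-- then 𝓒 K₂ ≐ 𝕌ℙ₁, but p , p ↛ q ⊢ p ↛ id q fails in 𝓑 K₁ • 𝓑 K₂.
FormsUP₁ : Connectives → Set
FormsUP₁ K = 𝓒 K ≐ 𝕌ℙ₁ × (∀ c → TopLike K c)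

module Submission where

open import Defs
open import Axiom.ExcludedMiddle using (ExcludedMiddle)
open import Data.Bool.Base using (Bool; true; false; _∧_; _∨_; not; if_then_else_)
open import Data.Bool.Properties using (∧-comm; ∧-idem; T-≡; not-involutive)
open import Data.Empty using (⊥; ⊥-elim)
open import Data.Fin.Base using (Fin; zero; suc; punchOut)
open import Data.Fin.Properties using (suc-injective)
open import Data.List.Base as List using (List)
open import Data.List.Membership.Propositional using () renaming (_∈_ to _∈ˡ_)
open import Data.List.Membership.Propositional.Properties using (∈-map⁺; ∈-++⁺ˡ; ∈-++⁺ʳ)
open import Data.List.Relation.Unary.All as ListAll using ()
open import Data.List.Relation.Unary.All.Properties using (++⁺; ++⁻ˡ; ++⁻ʳ)
open import Data.List.Relation.Unary.Any using (here; there)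
open import Data.Nat.Base using (ℕ; zero; suc; _≤_; _≤ᵇ_; _⊔_; s≤s; z≤n)
open import Data.Nat.Properties
  using (_≤?_; ≤-refl; ≤-trans; ≤-reflexive; ≤ᵇ⇒≤; ≤⇒≤ᵇ; m≤m⊔n; m≤n⊔m; n≤1+n; 1+n≰n; ⊔-idem; ⊔-comm;
         m≤n⇒m≤1+n)
open import Data.Product.Base using (∃; ∃₂; _×_; _,_; proj₁; proj₂)
open import Data.Sum.Base as Sum using (_⊎_; inj₁; inj₂; [_,_])
open import Data.Vec.Base
  using (Vec; []; _∷_; head; lookup; map; replicate; tabulate; zipWith; countᵇ; removeAt)
open import Data.Vec.Properties
  using (map-∘; map-cong; map-id; lookup-map; lookup-replicate; lookup-zipWith; tabulate∘lookup;
         tabulate-∘; tabulate-cong; lookup∘tabulate; removeAt-punchOut)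
open import Data.Vec.Relation.Unary.All as All using (All; []; _∷_)
open import Data.Vec.Relation.Unary.All.Properties using (tabulate⁺; tabulate⁻; lookup⁺; lookup⁻)
open import Function.Base using (_∘_; id)
open import Function.Bundles using (_⇔_; mk⇔; Equivalence)
open import Level using (0ℓ) renaming (suc to lsuc)
open import Relation.Binary.PropositionalEquality
  using (_≡_; _≢_; _≗_; refl; sym; trans; cong; cong₂; subst)
open import Relation.Nullary.Decidable.Core using (yes; no)
open import Relation.Nullary.Negation.Core using (¬_)
open import Relation.Unary using (Pred; _∈_; _⊆_; _∪_; _≐_)

-- A set of formulas is a theory of the fibring iff it is an intersection of K₁-valuations and also an
-- intersection of K₂-valuations, where formulas headed by the other signature behave like variables.
--
-- If all connectives of K₂ are top-like, the K₂-headed formulas are theorems, nothing is left to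
-- choose, and the fibring is classical.
--
-- Conversely, suppose that some connective f of K₁ does not preserve binary meets and that K₂ has a
-- connective g that is not top-like.  If g has positive arity, then two distinct classically false
-- K₂-headed formulas γ₁ and γ₂ may be given the values (0,1) and (1,0) under two K₁-valuations,
-- which turns f(x ∧ y) into f(x) ∧ f(y) and so refutes a classical inference.  If K₂ has constant
-- connectives only, a bottom ⊥ may be given the value (0,1), and then ⊢ ⊥ → q and p , p → q ⊢ q
-- cannot both hold, q having the value (1,0).  By symmetry, a classical fibring in which neither
-- side is top-like would have only meet-preserving connectives, which are not complete.
--
-- Finally, an incomplete clone C that becomes complete with the constant 1 contains, for every g,
-- some t with t(1,x) = g(x).  If C is not 0-preserving, it contains ¬ and is the clone of all
-- self-dual functions.  Otherwise it contains ↛ and is closed under going down pointwise, so it is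
-- determined by the least k, if any, for which k+1 points of some f⁻¹(1) have no coordinate equal
-- to 1 in common.

open Connectives using (⟦_⟧)

private
  variable
    A B V : Set
    Σ : Signature
    m n : ℕ

-- Terms and homomorphisms

extends≡map : (alg : (c : Symbol Σ) → Vec B (arity Σ c) → B) (ρ : V → B)
              (ts : Vec (Formula Σ V) n) → extends alg ρ ts ≡ map (extend alg ρ) ts
extends≡map alg ρ []       = refl
extends≡map alg ρ (t ∷ ts) = cong (extend alg ρ t ∷_) (extends≡map alg ρ ts)

module _ {alg : (c : Symbol Σ) → Vec A (arity Σ c) → A}
         {alg′ : (c : Symbol Σ) → Vec B (arity Σ c) → B}
         {ρ : V → A} {ρ′ : V → B} (h : A → B)
         (hom : ∀ c as → h (alg c as) ≡ alg′ c (map h as))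
         (base : ∀ x → h (ρ x) ≡ ρ′ x) where

  -- Uniqueness of the homomorphism out of the free algebra. Most evaluation identities below are
  -- instances, with `h` a valuation, a component of a model or a translation of formulas.
  extend-fusion  : ∀ φ → h (extend alg ρ φ) ≡ extend alg′ ρ′ φ
  extends-fusion : (ts : Vec (Formula Σ V) n) →
                   map h (extends alg ρ ts) ≡ extends alg′ ρ′ ts

  extend-fusion (var x)    = base x
  extend-fusion (con c ts) =
    trans (hom c (extends alg ρ ts)) (cong (alg′ c) (extends-fusion ts))

  extends-fusion []       = refl
  extends-fusion (t ∷ ts) = cong₂ _∷_ (extend-fusion t) (extends-fusion ts)

extend-var : (φ : Formula Σ V) → extend con var φ ≡ φ
extends-var : (ts : Vec (Formula Σ V) n) → extends con var ts ≡ ts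
extend-var (var x)    = refl
extend-var (con c ts) = cong (con c) (extends-var ts)
extends-var []       = refl
extends-var (t ∷ ts) = cong₂ _∷_ (extend-var t) (extends-var ts)

extend-extend : {W : Set} (alg : (c : Symbol Σ) → Vec B (arity Σ c) → B) (ρ : W → B)
                (σ : V → Formula Σ W) (φ : Formula Σ V) →
                extend alg ρ (extend con σ φ) ≡ extend alg (extend alg ρ ∘ σ) φ
extend-extend alg ρ σ = extend-fusion (extend alg ρ)
  (λ c ts → cong (alg c) (extends≡map alg ρ ts)) (λ _ → refl)

instantiate : Formula Σ (Fin n) → Vec (Formula Σ V) n → Formula Σ V
instantiate φ ts = extend con (lookup ts) φ

module _ (K : Connectives) where

  extend-isValuation : ∀ ρ → IsValuation K (extend ⟦ K ⟧ ρ)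
  extend-isValuation ρ c ts = cong (⟦ K ⟧ c) (extends≡map ⟦ K ⟧ ρ ts)

  valuation-extend : ∀ {v} → IsValuation K v → ∀ φ → v φ ≡ extend ⟦ K ⟧ (v ∘ var) φ
  valuation-extend {v} val φ = trans (cong v (sym (extend-var φ)))
    (extend-fusion v val (λ _ → refl) φ)

  valuation-instantiate : ∀ {v} → IsValuation K v → (φ : Formula (signature K) (Fin n)) →
    ∀ ts → v (instantiate φ ts) ≡ termFunction K φ (map v ts)
  valuation-instantiate {v = v} val φ ts =
    extend-fusion v val (λ i → sym (lookup-map i v ts)) φ

module _ {Σ₁ Σ₂ : Signature} where

  -- Restricted to formulas of one component, `h` after evaluation is a valuation there, so
  -- entailments of that component apply to it. Only the corresponding half of `alg` has to be
  -- respected by `h`.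
  valuation-injectˡ : (alg : (c : Symbol (Σ₁ ⊕ Σ₂)) → Vec B (arity (Σ₁ ⊕ Σ₂) c) → B)
    (f : ∀ c → Vec Bool (arity Σ₁ c) → Bool) (h : B → Bool) →
    (∀ c bs → h (alg (inj₁ c) bs) ≡ f c (map h bs)) → ∀ ρ c (ts : Vec (L Σ₁) (arity Σ₁ c)) →
    h (extend alg ρ (injectˡ {Σ₁} {Σ₂} (con c ts))) ≡
    f c (map (λ t → h (extend alg ρ (injectˡ {Σ₁} {Σ₂} t))) ts)
  valuation-injectˡ alg f h hom ρ c ts = trans (hom c _) (cong (f c)
    (trans (cong (map h) (trans (cong (extends alg ρ) (extends≡map _ _ ts))
      (trans (extends≡map alg ρ _) (sym (map-∘ _ _ ts))))) (sym (map-∘ h _ ts))))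

  valuation-injectʳ : (alg : (c : Symbol (Σ₁ ⊕ Σ₂)) → Vec B (arity (Σ₁ ⊕ Σ₂) c) → B)
    (f : ∀ c → Vec Bool (arity Σ₂ c) → Bool) (h : B → Bool) →
    (∀ c bs → h (alg (inj₂ c) bs) ≡ f c (map h bs)) → ∀ ρ c (ts : Vec (L Σ₂) (arity Σ₂ c)) →
    h (extend alg ρ (injectʳ {Σ₁} {Σ₂} (con c ts))) ≡
    f c (map (λ t → h (extend alg ρ (injectʳ {Σ₁} {Σ₂} t))) ts)
  valuation-injectʳ alg f h hom ρ c ts = trans (hom c _) (cong (f c)
    (trans (cong (map h) (trans (cong (extends alg ρ) (extends≡map _ _ ts))
      (trans (extends≡map alg ρ _) (sym (map-∘ _ _ ts))))) (sym (map-∘ h _ ts))))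

-- Models of the fibring

-- An algebra whose designated elements are cut out by two homomorphisms for K₁ and by
-- a single one for K₂ is a model of the fibring, although K₁ ∪ K₂ as a whole need not
-- be interpreted classically.
module Model {K₁ K₂ : Connectives} {B : Set}
  (alg : (c : Symbol (signature (K₁ ⊎ᶜ K₂))) → Vec B (arity (signature (K₁ ⊎ᶜ K₂)) c) → B)
  (a b : B → Bool)
  (hom-a : ∀ c bs → a (alg (inj₁ c) bs) ≡ ⟦ K₁ ⟧ c (map a bs))
  (hom-b : ∀ c bs → b (alg (inj₁ c) bs) ≡ ⟦ K₁ ⟧ c (map b bs))
  (hom-d : ∀ c bs → a (alg (inj₂ c) bs) ∧ b (alg (inj₂ c) bs) ≡
                    ⟦ K₂ ⟧ c (map (λ x → a x ∧ b x) bs)) where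

  private
    Σ₁ = signature K₁
    Σ₂ = signature K₂
    d : B → Bool
    d x = a x ∧ b x

    ∧-true : ∀ {x y} → x ∧ y ≡ true → x ≡ true × y ≡ true
    ∧-true {true} {true} _ = refl , refl

    modelLogic : Logic (Σ₁ ⊕ Σ₂) 0ℓ
    modelLogic = record
      { _⊢_ = λ Γ C → ∀ ρ → (∀ {G} → G ∈ Γ → d (extend alg ρ G) ≡ true) →
                       d (extend alg ρ C) ≡ true
      ; R   = λ C∈Γ ρ Γ₁ → Γ₁ C∈Γ
      ; M   = λ Γ⊆Δ e ρ Δ₁ → e ρ (λ G∈Γ → Δ₁ (Γ⊆Δ G∈Γ))
      ; T   = λ es e ρ Γ₁ → e ρ [ Γ₁ , (λ D∈Δ → es D∈Δ ρ Γ₁) ]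
      ; SI  = λ {Γ} {C} σ e ρ Γσ₁ →
                trans (cong d (extend-extend alg ρ σ C))
                  (e (extend alg ρ ∘ σ) (λ {G} G∈Γ →
                    trans (cong d (sym (extend-extend alg ρ σ G))) (Γσ₁ (G , G∈Γ , refl))))
      }

  -- Rules of `K₁` hold under `a` and under `b` separately, hence under their conjunction. Rules of
  -- `K₂` are applied to the meet `d` itself.
  sound : ∀ {Γ C} → Fibred (𝓑 K₁) (𝓑 K₂) Γ C → Logic._⊢_ modelLogic Γ C
  sound = •-least (𝓑 K₁) (𝓑 K₂) modelLogic
    (λ e ρ Γ₁ → cong₂ _∧_
      (e _ (valuation-injectˡ alg ⟦ K₁ ⟧ a hom-a ρ) (λ G∈Γ → proj₁ (∧-true (Γ₁ (_ , G∈Γ , refl)))))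
      (e _ (valuation-injectˡ alg ⟦ K₁ ⟧ b hom-b ρ) (λ {G} G∈Γ → proj₂ (∧-true {a _} (Γ₁ (_ , G∈Γ , refl))))))
    (λ e ρ Γ₁ → e _ (valuation-injectʳ alg ⟦ K₂ ⟧ d hom-d ρ) (λ G∈Γ → Γ₁ (_ , G∈Γ , refl)))

Classical : Connectives → Connectives → Set₁
Classical K₁ K₂ = 𝓑 K₁ • 𝓑 K₂ ≈ 𝓑 (K₁ ⊎ᶜ K₂)

module _ {K₁ K₂ : Connectives} where

  private
    K = K₁ ⊎ᶜ K₂

  -- Valuations of the union restrict to valuations of both components. Hence only completeness of
  -- the fibring is ever at stake in `Classical`.
  fibring-sound : ∀ {Γ C} → Fibred (𝓑 K₁) (𝓑 K₂) Γ C → Entails K Γ C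
  fibring-sound = •-least (𝓑 K₁) (𝓑 K₂) (𝓑 K)
    (λ e v val Γ₁ → e (v ∘ injectˡ)
      (λ c ts → trans (val _ _) (cong (⟦ K₁ ⟧ c)
        (trans (cong (map v) (extends≡map _ _ ts)) (sym (map-∘ v _ ts)))))
      (λ G∈Γ → Γ₁ (_ , G∈Γ , refl)))
    (λ e v val Γ₁ → e (v ∘ injectʳ)
      (λ c ts → trans (val _ _) (cong (⟦ K₂ ⟧ c)
        (trans (cong (map v) (extends≡map _ _ ts)) (sym (map-∘ v _ ts)))))
      (λ G∈Γ → Γ₁ (_ , G∈Γ , refl)))

-- Exchanging the two signatures

swap : {Σ₁ Σ₂ : Signature} → Formula (Σ₁ ⊕ Σ₂) V → Formula (Σ₂ ⊕ Σ₁) V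
swap {Σ₁ = Σ₁} {Σ₂} = extend swapped var
  where
  swapped : (c : Symbol (Σ₁ ⊕ Σ₂)) → Vec (Formula (Σ₂ ⊕ Σ₁) _) (arity (Σ₁ ⊕ Σ₂) c) →
            Formula (Σ₂ ⊕ Σ₁) _
  swapped (inj₁ c) = con (inj₂ c)
  swapped (inj₂ c) = con (inj₁ c)

module _ {Σ₁ Σ₂ : Signature} where

  private
    sw : Formula (Σ₁ ⊕ Σ₂) V → Formula (Σ₂ ⊕ Σ₁) V
    sw = swap {Σ₁ = Σ₁} {Σ₂}

  extend-swap : ∀ {alg : (c : Symbol (Σ₂ ⊕ Σ₁)) → Vec B (arity (Σ₂ ⊕ Σ₁) c) → B}
    {alg′ : (c : Symbol (Σ₁ ⊕ Σ₂)) → Vec B (arity (Σ₁ ⊕ Σ₂) c) → B} {ρ ρ′ : V → B} →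
    (∀ c bs → alg (inj₂ c) bs ≡ alg′ (inj₁ c) bs) →
    (∀ c bs → alg (inj₁ c) bs ≡ alg′ (inj₂ c) bs) → (∀ x → ρ x ≡ ρ′ x) →
    ∀ φ → extend alg ρ (sw φ) ≡ extend alg′ ρ′ φ
  extend-swap {alg = alg} {ρ = ρ} e₁ e₂ = extend-fusion (extend alg ρ)
    λ { (inj₁ c) ts → trans (cong (alg (inj₂ c)) (extends≡map alg ρ ts)) (e₁ c _)
      ; (inj₂ c) ts → trans (cong (alg (inj₁ c)) (extends≡map alg ρ ts)) (e₂ c _) }

swap-swap : {Σ₁ Σ₂ : Signature} (φ : Formula (Σ₁ ⊕ Σ₂) V) →
            swap {Σ₁ = Σ₂} {Σ₁} (swap {Σ₁ = Σ₁} {Σ₂} φ) ≡ φ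
swap-swap {Σ₁ = Σ₁} {Σ₂} φ = trans
  (extend-swap {Σ₁ = Σ₁} {Σ₂} {alg′ = con} {ρ′ = var} (λ _ _ → refl) (λ _ _ → refl) (λ _ → refl) φ)
  (extend-var φ)

functionallyComplete-swap : ∀ K₁ K₂ → FunctionallyComplete (K₁ ⊎ᶜ K₂) →
                            FunctionallyComplete (K₂ ⊎ᶜ K₁)
functionallyComplete-swap K₁ K₂ complete f with complete f
... | φ , φ≗f = swap {Σ₁ = signature K₁} {signature K₂} φ , λ xs → trans
  (extend-swap {Σ₁ = signature K₁} {signature K₂} (λ _ _ → refl) (λ _ _ → refl) (λ _ → refl) φ) (φ≗f xs)

module _ (K₁ K₂ : Connectives) where

  private
    Σ₁ = signature K₁
    Σ₂ = signature K₂
    sw : L (Σ₁ ⊕ Σ₂) → L (Σ₂ ⊕ Σ₁)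
    sw = swap {Σ₁ = Σ₁} {Σ₂}
    module F = Logic (𝓑 K₂ • 𝓑 K₁)

    sw-substitute : ∀ σ φ → sw (substitute σ φ) ≡ substitute (sw ∘ σ) (sw φ)
    sw-substitute σ φ = trans
      (extend-fusion {alg′ = λ { (inj₁ c) → con (inj₂ c) ; (inj₂ c) → con (inj₁ c) }}
        {ρ′ = sw ∘ σ} sw
        (λ { (inj₁ c) ts → cong (con (inj₂ c)) (extends≡map _ _ ts)
           ; (inj₂ c) ts → cong (con (inj₁ c)) (extends≡map _ _ ts) }) (λ _ → refl) φ)
      (sym (extend-swap {Σ₁ = Σ₁} {Σ₂} (λ _ _ → refl) (λ _ _ → refl) (λ _ → refl) φ))

    swapLogic : Logic (Σ₁ ⊕ Σ₂) (lsuc 0ℓ)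
    swapLogic = record
      { _⊢_ = λ Γ C → image sw Γ F.⊢ sw C
      ; R   = λ C∈Γ → F.R (_ , C∈Γ , refl)
      ; M   = λ Γ⊆Δ → F.M (λ { (G , G∈Γ , e) → G , Γ⊆Δ G∈Γ , e })
      ; T   = λ {Γ} {Δ} ds d → F.T {Δ = image sw Δ} (λ { (D , D∈Δ , refl) → ds D∈Δ })
                (F.M (λ { (G , inj₁ G∈Γ , e) → inj₁ (G , G∈Γ , e)
                        ; (D , inj₂ D∈Δ , e) → inj₂ (D , D∈Δ , e) }) d)
      ; SI  = λ {Γ} {C} σ d → subst (_ F.⊢_) (sym (sw-substitute σ C))
                (F.M (λ { (_ , (G , G∈Γ , refl) , refl) →
                          substitute σ G , (G , G∈Γ , refl) , sym (sw-substitute σ G) })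
                  (F.SI (sw ∘ σ) d))
      }

    -- Derivability of the swapped inference is itself a consequence relation extending both
    -- components, so leastness of the fibring applies.
    fibred-swap : ∀ {Γ C} → Fibred (𝓑 K₁) (𝓑 K₂) Γ C → image sw Γ F.⊢ sw C
    fibred-swap = •-least (𝓑 K₁) (𝓑 K₂) swapLogic
      (λ {Γ} {C} d → subst (_ F.⊢_) (sym (sw-injectˡ C))
        (F.M (λ { (G , G∈Γ , refl) → injectˡ G , (G , G∈Γ , refl) , sym (sw-injectˡ G) })
          (inclʳ d)))
      (λ {Γ} {C} d → subst (_ F.⊢_) (sym (sw-injectʳ C))
        (F.M (λ { (G , G∈Γ , refl) → injectʳ G , (G , G∈Γ , refl) , sym (sw-injectʳ G) })
          (inclˡ d)))
      where
      sw-injectˡ : ∀ φ → sw (injectˡ φ) ≡ injectʳ φ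
      sw-injectˡ = extend-fusion sw
        (λ c ts → cong (con (inj₂ c)) (extends≡map _ _ ts)) (λ _ → refl)
      sw-injectʳ : ∀ φ → sw (injectʳ φ) ≡ injectˡ φ
      sw-injectʳ = extend-fusion sw
        (λ c ts → cong (con (inj₁ c)) (extends≡map _ _ ts)) (λ _ → refl)

  classical-swap : Classical K₁ K₂ → Classical K₂ K₁
  classical-swap classical Γ C = mk⇔ fibring-sound λ e →
    subst (Γ F.⊢_) (swap-swap C)
      (F.M (λ { (_ , (G , G∈Γ , refl) , refl) → subst Γ (sym (swap-swap G)) G∈Γ })
        (fibred-swap (Equivalence.from (classical (image sw′ Γ) (sw′ C)) (swapped e))))
    where
    sw′ : L (Σ₂ ⊕ Σ₁) → L (Σ₁ ⊕ Σ₂)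
    sw′ = swap {Σ₁ = Σ₂} {Σ₁}

    swapped : Entails (K₂ ⊎ᶜ K₁) Γ C → Entails (K₁ ⊎ᶜ K₂) (image sw′ Γ) (sw′ C)
    swapped e v val Γ₁ = trans (eval C) (e _ (extend-isValuation (K₂ ⊎ᶜ K₁) (v ∘ var))
      (λ {G} G∈Γ → trans (sym (eval G)) (Γ₁ (G , G∈Γ , refl))))
      where
      eval : ∀ φ → v (sw′ φ) ≡ extend ⟦ K₂ ⊎ᶜ K₁ ⟧ (v ∘ var) φ
      eval φ = trans (valuation-extend (K₁ ⊎ᶜ K₂) val (sw′ φ))
        (extend-swap {Σ₁ = Σ₂} {Σ₁} (λ _ _ → refl) (λ _ _ → refl) (λ _ → refl) φ)

-- Top-like connectives

module TopLikeRight (K₁ K₂ : Connectives) (topLike : ∀ c → TopLike K₂ c) where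

  private
    Σ₁ = signature K₁
    Σ₂ = signature K₂
    K  = K₁ ⊎ᶜ K₂
    E  = L (Σ₁ ⊕ Σ₂)
    module F = Logic (𝓑 K₁ • 𝓑 K₂)

  -- The places where `K₁` stops seeing structure. In `skeleton` each of them becomes a variable,
  -- numbered by `ν`.
  leaves  : E → List E
  leavess : Vec E n → List E
  leaves (var i)           = var i List.∷ List.[]
  leaves (con (inj₁ c) ts) = leavess ts
  leaves (con (inj₂ c) ts) = con (inj₂ c) ts List.∷ List.[]
  leavess []       = List.[]
  leavess (t ∷ ts) = leaves t List.++ leavess ts

  skeleton  : (E → ℕ) → E → L Σ₁
  skeletons : (E → ℕ) → Vec E n → Vec (L Σ₁) n
  skeleton ν (var i)           = var (ν (var i))
  skeleton ν (con (inj₁ c) ts) = con c (skeletons ν ts)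
  skeleton ν (con (inj₂ c) ts) = var (ν (con (inj₂ c) ts))
  skeletons ν []       = []
  skeletons ν (t ∷ ts) = skeleton ν t ∷ skeletons ν ts

  -- Applied to pairwise distinct variables, `c` gives a theorem of `𝓑 K₂`; (SI) then puts the
  -- actual arguments `ts` in their place.
  K₂-theorem : ∀ c ts → Fibred (𝓑 K₁) (𝓑 K₂) (λ _ → ⊥) (con (inj₂ c) ts)
  K₂-theorem c ts = subst (F._⊢_ _) (cong (con (inj₂ c)) eq)
    (F.M (λ { (_ , (_ , () , _) , _) })
      (F.SI σ (inclʳ {Γ = λ _ → ⊥} {C = con c vs} λ v val _ → trans (val c vs) (topLike c _))))
    where
    numbered : Vec ℕ n
    numbered {zero}  = []
    numbered {suc n} = 0 ∷ map suc numbered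
    nth : Vec E n → ℕ → E
    nth []       _       = var 0
    nth (u ∷ us) zero    = u
    nth (u ∷ us) (suc i) = nth us i
    nth-numbered : (us : Vec E n) → map (nth us) numbered ≡ us
    nth-numbered []       = refl
    nth-numbered (u ∷ us) =
      cong (u ∷_) (trans (sym (map-∘ (nth (u ∷ us)) suc numbered)) (nth-numbered us))
    vs = map var numbered
    σ  = nth ts
    eq : extends con σ (extends (λ c → con (inj₂ c)) var vs) ≡ ts
    eq = trans (trans (cong (extends con σ)
           (trans (extends≡map _ _ vs) (sym (map-∘ _ _ numbered))))
         (trans (extends≡map _ _ (map var numbered)) (sym (map-∘ _ _ numbered)))) (nth-numbered ts)

  data K₂-headed : E → Set where
    headed : ∀ c ts → K₂-headed (con (inj₂ c) ts)

  module _ (ν : E → ℕ) (σ : ℕ → E) where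

    -- Demanded only of the leaves in play: the signature may be uncountable, and then no `ν` and
    -- `σ` code all formulas.
    Coded : E → Set
    Coded φ = σ (ν φ) ≡ φ

    LeavesCoded : E → Set
    LeavesCoded φ = ListAll.All Coded (leaves φ)

    substitute-skeleton : ∀ φ → LeavesCoded φ →
                          substitute σ (injectˡ (skeleton ν φ)) ≡ φ
    substitute-skeletons : (ts : Vec E n) → ListAll.All Coded (leavess ts) →
      extends con σ (extends (λ c → con (inj₁ c)) var (skeletons ν ts)) ≡ ts
    substitute-skeleton (var i)           (e ListAll.∷ _) = e
    substitute-skeleton (con (inj₁ c) ts) es = cong (con (inj₁ c)) (substitute-skeletons ts es)
    substitute-skeleton (con (inj₂ c) ts) (e ListAll.∷ _) = e
    substitute-skeletons []       _  = refl
    substitute-skeletons (t ∷ ts) es = cong₂ _∷_ (substitute-skeleton t (++⁻ˡ (leaves t) es))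
      (substitute-skeletons ts (++⁻ʳ (leaves t) es))

    module _ {v : L Σ₁ → Bool} (val : IsValuation K₁ v)
             (v-headed : ∀ {h} → K₂-headed h → Coded h → v (var (ν h)) ≡ true) where

      private
        w : E → Bool
        w = extend ⟦ K ⟧ (λ i → v (var (ν (var i))))

      -- A `K₂`-headed leaf is classically true, so a `K₁`-valuation that makes its code true
      -- computes the classical value of the whole formula.
      skeleton-value  : ∀ φ → LeavesCoded φ → v (skeleton ν φ) ≡ w φ
      skeletons-value : (ts : Vec E n) → ListAll.All Coded (leavess ts) →
        map v (skeletons ν ts) ≡ extends ⟦ K ⟧ (λ i → v (var (ν (var i)))) ts
      skeleton-value (var i)           _  = refl
      skeleton-value (con (inj₁ c) ts) es =
        trans (val c _) (cong (⟦ K₁ ⟧ c) (skeletons-value ts es))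
      skeleton-value (con (inj₂ c) ts) (e ListAll.∷ _) =
        trans (v-headed (headed c ts) e) (sym (topLike c _))
      skeletons-value []       _  = refl
      skeletons-value (t ∷ ts) es = cong₂ _∷_ (skeleton-value t (++⁻ˡ (leaves t) es))
        (skeletons-value ts (++⁻ʳ (leaves t) es))

    -- The skeleton of the inference becomes valid in `𝓑 K₁` once the codes of `K₂`-headed leaves
    -- are added as premises. Substituting `σ` turns these extra premises into theorems, which (T)
    -- removes.
    coded-complete : ∀ {Γ C} → (∀ {G} → G ∈ Γ → LeavesCoded G) → LeavesCoded C →
                     Entails K Γ C → Γ F.⊢ C
    coded-complete {Γ} {C} Γ-coded C-coded e =
      subst (Γ F.⊢_) (substitute-skeleton C C-coded)
        (F.T {Δ = λ h → K₂-headed h × Coded h} (λ { (headed c ts , _) → F.M (λ ()) (K₂-theorem c ts) })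
          (F.M premise (F.SI σ (inclˡ entails₁))))
      where
      Γ₁ : Pred (L Σ₁) 0ℓ
      Γ₁ φ = (∃ λ G → G ∈ Γ × φ ≡ skeleton ν G) ⊎
             (∃ λ h → (K₂-headed h × Coded h) × φ ≡ var (ν h))
      premise : image (substitute σ) (image injectˡ Γ₁) ⊆ (Γ ∪ (λ h → K₂-headed h × Coded h))
      premise (_ , (_ , inj₁ (G , G∈Γ , refl) , refl) , refl) =
        inj₁ (subst Γ (sym (substitute-skeleton G (Γ-coded G∈Γ))) G∈Γ)
      premise (_ , (_ , inj₂ (h , p , refl) , refl) , refl) =
        inj₂ (subst (λ h → K₂-headed h × Coded h) (sym (proj₂ p)) p)
      entails₁ : Entails K₁ Γ₁ (skeleton ν C)
      entails₁ v val vΓ₁ = trans (value C C-coded)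
        (e _ (extend-isValuation K _) (λ {G} G∈Γ →
          trans (sym (value G (Γ-coded G∈Γ))) (vΓ₁ (inj₁ (G , G∈Γ , refl)))))
        where
        value = skeleton-value {v} val (λ {h} h-headed h-coded → vΓ₁ (inj₂ (h , (h-headed , h-coded) , refl)))

  module _ (em : ∀ {ℓ} → ExcludedMiddle ℓ) where

    -- The newest formula takes the number 0 and all other numbers move up by one; excluded middle
    -- decides equality of formulas.
    coding : (hs : List E) → ∃₂ λ ν σ → ListAll.All (Coded ν σ) hs
    coding List.[] = (λ _ → 0) , (λ _ → var 0) , ListAll.[]
    coding (h List.∷ hs) with coding hs
    ... | ν , σ , coded = ν′ , σ′ , h-coded ListAll.∷ ListAll.map (λ {x} → still-coded x) coded
      where
      ν′ : E → ℕ
      ν′ x with em {P = x ≡ h}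
      ... | yes _ = 0
      ... | no  _ = suc (ν x)
      σ′ : ℕ → E
      σ′ zero    = h
      σ′ (suc i) = σ i
      h-coded : σ′ (ν′ h) ≡ h
      h-coded with em {P = h ≡ h}
      ... | yes _ = refl
      ... | no ne = ⊥-elim (ne refl)
      still-coded : ∀ x → Coded ν σ x → σ′ (ν′ x) ≡ x
      still-coded x e with em {P = x ≡ h}
      ... | yes x≡h = sym x≡h
      ... | no  _   = e

    singleton-complete : ∀ G C → Entails K (G ≡_) C → (G ≡_) F.⊢ C
    singleton-complete G C with coding (leaves G List.++ leaves C)
    ... | ν , σ , coded =
      coded-complete ν σ (λ { refl → ++⁻ˡ (leaves G) coded }) (++⁻ʳ (leaves G) coded)

    -- Γ may use uncountably many K₂-headed formulas.  They are all replaced by a single one,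
    -- one member of Γ at a time.
    module _ (c₀ : Symbol Σ₂) where

      private
        ⊤₀ : E
        ⊤₀ = con (inj₂ c₀) (replicate _ (var 0))

        replaceAlg : (c : Symbol (Σ₁ ⊕ Σ₂)) → Vec E (arity (Σ₁ ⊕ Σ₂) c) → E
        replaceAlg (inj₁ c) ts = con (inj₁ c) ts
        replaceAlg (inj₂ c) ts = ⊤₀

        replace : E → E
        replace = extend replaceAlg var

        value-replace : ∀ {v} → IsValuation K v → ∀ φ → v (replace φ) ≡ v φ
        value-replace {v} val φ = trans
          (extend-fusion v (λ { (inj₁ c) → val (inj₁ c) ; (inj₂ c) ts →
            trans (val (inj₂ c₀) _) (trans (topLike c₀ _) (sym (topLike c _))) }) (λ _ → refl) φ)
          (sym (valuation-extend K val φ))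

        -- After replacement the only leaves are variables and `⊤₀`, so a single coding, with 0
        -- reserved for `⊤₀`, serves all of `Γ` at once.
        ν : E → ℕ
        ν (var i)   = suc i
        ν (con _ _) = 0
        σ : ℕ → E
        σ zero    = ⊤₀
        σ (suc i) = var i

        replace-coded  : ∀ φ → LeavesCoded ν σ (replace φ)
        replace-codeds : (ts : Vec E n) → ListAll.All (Coded ν σ) (leavess (extends replaceAlg var ts))
        replace-coded (var i)           = refl ListAll.∷ ListAll.[]
        replace-coded (con (inj₁ c) ts) = replace-codeds ts
        replace-coded (con (inj₂ c) ts) = refl ListAll.∷ ListAll.[]
        replace-codeds []       = ListAll.[]
        replace-codeds (t ∷ ts) = ++⁺ (replace-coded t) (replace-codeds ts)

      classical : Classical K₁ K₂
      classical Γ C = mk⇔ fibring-sound λ e →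
        -- The route is from `Γ` to its replaced form, on to `replace C`, and back to `C`. The first
        -- leg treats each premise alone and the last has one premise, so a finite coding suffices
        -- there.
        F.T {Δ = image replace Γ} (λ { (G , G∈Γ , refl) →
            F.M (λ { refl → G∈Γ })
              (singleton-complete G (replace G) λ v val vG → trans (value-replace val G) (vG refl)) })
          (F.T {Δ = replace C ≡_} (λ { refl → F.M inj₂
              (coded-complete ν σ (λ { (G , _ , refl) → replace-coded G }) (replace-coded C)
                λ v val vΓ → trans (value-replace val C) (e v val λ {G} G∈Γ →
                  trans (sym (value-replace val G)) (vΓ (G , G∈Γ , refl)))) })
            (F.M inj₂ (singleton-complete (replace C) C λ v val vC →
              trans (sym (value-replace val C)) (vC refl))))

-- Models in which formulas of high rank are not classical

false≢true : false ≢ true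
false≢true ()

maximum : Vec ℕ n → ℕ
maximum []       = 0
maximum (r ∷ rs) = r ⊔ maximum rs

-- Positive length matters here: the empty maximum is 0, whatever `r` is.
maximum-constant : ∀ {m r} (k : A → ℕ) → (∀ x → k x ≡ r) → (xs : Vec A n) → n ≡ suc m →
                   maximum (map k xs) ≡ r
maximum-constant k k≡r (x ∷ [])         _ = trans (cong (_⊔ 0) (k≡r x)) (⊔-comm _ 0)
maximum-constant k k≡r (x ∷ xs@(_ ∷ _)) _ =
  trans (cong₂ _⊔_ (k≡r x) (maximum-constant k k≡r xs refl)) (⊔-idem _)

map-zipWith : {C : Set} {h : B → C} {p : A → A → B} {k : A → A → C} →
              (∀ x y → h (p x y) ≡ k x y) →
              (xs ys : Vec A n) → map h (zipWith p xs ys) ≡ zipWith k xs ys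
map-zipWith e []       []       = refl
map-zipWith e (x ∷ xs) (y ∷ ys) = cong₂ _∷_ (e x y) (map-zipWith e xs ys)

zipWith-fst : (xs ys : Vec A n) → zipWith (λ x _ → x) xs ys ≡ xs
zipWith-fst []       []       = refl
zipWith-fst (x ∷ xs) (_ ∷ ys) = cong (x ∷_) (zipWith-fst xs ys)

zipWith-snd : (xs ys : Vec A n) → zipWith (λ _ y → y) xs ys ≡ ys
zipWith-snd []       []       = refl
zipWith-snd (_ ∷ xs) (y ∷ ys) = cong (y ∷_) (zipWith-snd xs ys)

PreservesMeets : (Vec Bool n → Bool) → Set
PreservesMeets f = ∀ xs ys → f (zipWith _∧_ xs ys) ≡ f xs ∧ f ys

-- A K₂-headed formula that is classically false need only be non-designated for the fibring,
-- so the two K₁-valuations may give it the values (0,1) or (1,0) instead of (0,0).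
-- This is done for formulas of high rank only, so that short formulas keep their classical values.
module RankModel (K₁ K₂ : Connectives) (D : ℕ) where

  private
    Σ₁ = signature K₁
    Σ₂ = signature K₂

  Value : Set
  Value = ℕ × Bool × Bool

  rank : Value → ℕ
  rank = proj₁
  left right designated : Value → Bool
  left       = proj₁ ∘ proj₂
  right      = proj₂ ∘ proj₂
  designated x = left x ∧ right x

  -- All three pairs have meet 0, so `K₂`, which is read through `designated`, cannot tell them
  -- apart. Ranks `D + 1` and `D + 2` are the ones used below.
  undesignated : ℕ → Bool × Bool
  undesignated r with r ≤? D | r ≤? suc D
  ... | yes _ | _     = false , false
  ... | no  _ | yes _ = false , true
  ... | no  _ | no  _ = true  , false

  settle : ℕ → Bool → Bool × Bool
  settle r true  = true , true
  settle r false = undesignated r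

  alg : (c : Symbol (Σ₁ ⊕ Σ₂)) → Vec Value (arity (Σ₁ ⊕ Σ₂) c) → Value
  alg (inj₁ c) xs = suc (maximum (map rank xs)) , ⟦ K₁ ⟧ c (map left xs) , ⟦ K₁ ⟧ c (map right xs)
  alg (inj₂ c) xs = suc (maximum (map rank xs)) ,
    settle (suc (maximum (map rank xs))) (⟦ K₂ ⟧ c (map designated xs))

  settle-designated : ∀ r b → proj₁ (settle r b) ∧ proj₂ (settle r b) ≡ b
  settle-designated r true  = refl
  settle-designated r false with r ≤? D | r ≤? suc D
  ... | yes _ | _     = refl
  ... | no  _ | yes _ = refl
  ... | no  _ | no  _ = refl

  sound : ∀ {Γ C} → Fibred (𝓑 K₁) (𝓑 K₂) Γ C → ∀ ρ →
          (∀ {G} → G ∈ Γ → designated (extend alg ρ G) ≡ true) → designated (extend alg ρ C) ≡ true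
  sound = Model.sound {K₁} {K₂} alg left right
    (λ _ _ → refl) (λ _ _ → refl) (λ c xs → settle-designated _ _)

  undesignated-low : ∀ {r} → r ≤ D → undesignated r ≡ (false , false)
  undesignated-low {r} r≤D with r ≤? D | r ≤? suc D
  ... | yes _  | _ = refl
  ... | no r≰D | _ = ⊥-elim (r≰D r≤D)

  undesignated-1+D : undesignated (suc D) ≡ (false , true)
  undesignated-1+D with suc D ≤? D | suc D ≤? suc D
  ... | yes p | _     = ⊥-elim (1+n≰n p)
  ... | no  _ | yes _ = refl
  ... | no  _ | no ¬p = ⊥-elim (¬p ≤-refl)

  undesignated-2+D : undesignated (suc (suc D)) ≡ (true , false)
  undesignated-2+D with suc (suc D) ≤? D | suc (suc D) ≤? suc D
  ... | yes p | _     = ⊥-elim (1+n≰n (≤-trans (n≤1+n _) p))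
  ... | no  _ | yes p = ⊥-elim (1+n≰n p)
  ... | no  _ | no  _ = refl

  dup : Bool → Bool × Bool
  dup w = w , w

  map-dup : (h : Bool × Bool → Bool) → (∀ w → h (dup w) ≡ w) → {xs : Vec Value n} {ws : Vec Bool n} →
            map proj₂ xs ≡ map dup ws → map (h ∘ proj₂) xs ≡ ws
  map-dup h h-dup {xs} {ws} e = trans (map-∘ h proj₂ xs) (trans (cong (map h) e)
    (trans (sym (map-∘ h dup ws)) (trans (map-cong h-dup ws) (map-id ws))))

  module _ {V : Set} (ρ : V → Value) (w : V → Bool) (ρ-classical : ∀ x → proj₂ (ρ x) ≡ dup (w x)) where

    private
      ⟦K⟧ = ⟦ K₁ ⊎ᶜ K₂ ⟧

    -- Subformulas have no larger rank, so `settle` only ever yields (0,0) or (1,1), and both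
    -- components follow the classical valuation.
    low-classical  : ∀ φ → rank (extend alg ρ φ) ≤ D → proj₂ (extend alg ρ φ) ≡ dup (extend ⟦K⟧ w φ)
    lows-classical : (ts : Vec (Formula (Σ₁ ⊕ Σ₂) V) n) → maximum (map rank (extends alg ρ ts)) ≤ D →
                     map proj₂ (extends alg ρ ts) ≡ map dup (extends ⟦K⟧ w ts)
    low-classical (var x) _ = ρ-classical x
    low-classical (con (inj₁ c) ts) low = cong₂ _,_
      (cong (⟦ K₁ ⟧ c) (map-dup proj₁ (λ _ → refl) e)) (cong (⟦ K₁ ⟧ c) (map-dup proj₂ (λ _ → refl) e))
      where e = lows-classical ts (≤-trans (n≤1+n _) low)
    low-classical (con (inj₂ c) ts) low = trans
      (cong (settle _) (cong (⟦ K₂ ⟧ c) (map-dup (λ p → proj₁ p ∧ proj₂ p) ∧-idem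
        (lows-classical ts (≤-trans (n≤1+n _) low)))))
      (settle-low (⟦ K₂ ⟧ c (extends ⟦K⟧ w ts)))
      where
      settle-low : ∀ b → settle (suc (maximum (map rank (extends alg ρ ts)))) b ≡ dup b
      settle-low true  = refl
      settle-low false = undesignated-low low
    lows-classical []       _   = refl
    lows-classical (t ∷ ts) low = cong₂ _∷_
      (low-classical t (≤-trans (m≤m⊔n _ _) low))
      (lows-classical ts (≤-trans (m≤n⊔m (rank (extend alg ρ t)) _) low))

-- What classicality forces on the connectives

module _ {K₁ K₂ : Connectives} (complete : FunctionallyComplete (K₁ ⊎ᶜ K₂))
         (classical : Classical K₁ K₂) where

  private
    Σ₁ = signature K₁
    Σ₂ = signature K₂
    K  = K₁ ⊎ᶜ K₂
    E  = L (Σ₁ ⊕ Σ₂)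

  module _ {c₁ : Symbol Σ₁} {xs ys : Vec Bool (arity Σ₁ c₁)}
           {c₂ : Symbol Σ₂} {as : Vec Bool (arity Σ₂ c₂)} {m : ℕ} (positive : arity Σ₂ c₂ ≡ suc m)
           (false-at-as : ⟦ K₂ ⟧ c₂ as ≡ false) where

    private
      neg : Formula (Σ₁ ⊕ Σ₂) (Fin 1)
      neg = proj₁ (complete (0 , negation))

      -- The rank of `neg` over a variable of rank 0, and so of `⊥₀`, which is thereby just low
      -- enough to keep its classical value.
      D : ℕ
      D = extend (λ _ rs → suc (maximum rs)) (λ _ → 0) neg

      open RankModel K₁ K₂ D

      -- All variables are true. Their ranks are padding: every argument of `γ₁` has rank `D` and
      -- every argument of `γ₂` rank `D + 1`, whatever mixture `as` prescribes.
      ρ : ℕ → Value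
      ρ 0 = 0 , true , true
      ρ 1 = D , true , true
      ρ _ = suc D , true , true

      eval = extend alg ρ

      ⊥₀ : E
      ⊥₀ = instantiate neg (var 0 ∷ [])

      -- With `u` true and `z` false the arguments spell out `as`, where `c₂` takes the value 0.
      γ : E → E → E
      γ u z = con (inj₂ c₂) (map (λ a → if a then u else z) as)

      γ₁ γ₂ : E
      γ₁ = γ (var 1) ⊥₀
      γ₂ = γ (var 2) γ₁

      -- In the model `pick s t` has left value `s` and right value `t`; classically, with all
      -- variables true, it has the value `s ∧ t`.
      pick : Bool → Bool → E
      pick true  true  = var 0
      pick true  false = γ₂
      pick false true  = γ₁
      pick false false = ⊥₀

      φ : E
      φ = con (inj₁ c₁) (zipWith pick xs ys)

      eval-⊥₀ : eval ⊥₀ ≡ (D , false , false)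
      eval-⊥₀ = cong₂ _,_ rank-⊥₀ (trans (cong proj₂ unfold)
        (trans (low-classical _ (lookup (true ∷ [])) (λ { zero → refl }) neg
          (≤-reflexive (trans (cong rank (sym unfold)) rank-⊥₀)))
          (cong dup (proj₂ (complete (0 , negation)) (true ∷ [])))))
        where
        unfold = extend-extend alg ρ (lookup (var 0 ∷ [])) neg
        rank-⊥₀ : rank (eval ⊥₀) ≡ D
        rank-⊥₀ = trans (cong rank unfold) (extend-fusion rank
          (λ { (inj₁ c) _ → refl ; (inj₂ c) _ → refl }) (λ { zero → refl }) neg)

      eval-γ : ∀ {u z r x} → eval u ≡ (r , true , true) → eval z ≡ (r , false , x) →
            eval (γ u z) ≡ (suc r , undesignated (suc r))
      eval-γ {u} {z} {r} {x} Vu Vz = cong₂ (λ s b → suc s , settle (suc s) b)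
        (trans (cong maximum (trans (cong (map rank) mapped) (sym (map-∘ rank F as))))
          (maximum-constant (rank ∘ F) (λ { true → cong rank Vu ; false → cong rank Vz }) as positive))
        (trans (cong (⟦ K₂ ⟧ c₂) (trans (cong (map designated) mapped)
          (trans (sym (map-∘ designated F as))
            (trans (map-cong (λ { true → cong designated Vu ; false → cong designated Vz }) as)
              (map-id as))))) false-at-as)
        where
        F : Bool → Value
        F a = eval (if a then u else z)
        mapped = trans (extends≡map alg ρ (map (λ a → if a then u else z) as)) (sym (map-∘ eval _ as))

      eval-γ₁ : eval γ₁ ≡ (suc D , false , true)
      eval-γ₁ = trans (eval-γ refl eval-⊥₀) (cong (suc D ,_) undesignated-1+D)

      eval-γ₂ : eval γ₂ ≡ (suc (suc D) , true , false)
      eval-γ₂ = trans (eval-γ refl eval-γ₁) (cong (suc (suc D) ,_) undesignated-2+D)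

      eval-φ : designated (eval φ) ≡ ⟦ K₁ ⟧ c₁ xs ∧ ⟦ K₁ ⟧ c₁ ys
      eval-φ = cong₂ (λ us vs → ⟦ K₁ ⟧ c₁ us ∧ ⟦ K₁ ⟧ c₁ vs)
        (trans (cong (map left) mapped) (trans (sym (map-∘ left eval picks))
          (trans (map-zipWith left-pick xs ys) (zipWith-fst xs ys))))
        (trans (cong (map right) mapped) (trans (sym (map-∘ right eval picks))
          (trans (map-zipWith right-pick xs ys) (zipWith-snd xs ys))))
        where
        picks  = zipWith pick xs ys
        mapped = extends≡map alg ρ picks
        left-pick : ∀ s t → left (eval (pick s t)) ≡ s
        left-pick true  true  = refl
        left-pick true  false = cong left eval-γ₂
        left-pick false true  = cong left eval-γ₁
        left-pick false false = cong left eval-⊥₀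
        right-pick : ∀ s t → right (eval (pick s t)) ≡ t
        right-pick true  true  = refl
        right-pick true  false = cong right eval-γ₂
        right-pick false true  = cong right eval-γ₁
        right-pick false false = cong right eval-⊥₀

      module _ {v : E → Bool} (val : IsValuation K v) (v-var : ∀ i → v (var i) ≡ true) where

        v-⊥₀ : v ⊥₀ ≡ false
        v-⊥₀ = trans (valuation-instantiate K val neg (var 0 ∷ []))
          (trans (proj₂ (complete (0 , negation)) _) (cong not (v-var 0)))

        v-γ : ∀ {u z} → v u ≡ true → v z ≡ false → v (γ u z) ≡ false
        v-γ vu vz = trans (val _ _) (trans (cong (⟦ K₂ ⟧ c₂) (trans (sym (map-∘ v _ as))
          (trans (map-cong (λ { true → vu ; false → vz }) as) (map-id as)))) false-at-as)

        v-φ : v φ ≡ ⟦ K₁ ⟧ c₁ (zipWith _∧_ xs ys)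
        v-φ = trans (val _ _) (cong (⟦ K₁ ⟧ c₁) (map-zipWith v-pick xs ys))
          where
          v-pick : ∀ s t → v (pick s t) ≡ s ∧ t
          v-pick true  true  = v-var 0
          v-pick true  false = v-γ (v-var 2) (v-γ (v-var 1) v-⊥₀)
          v-pick false true  = v-γ (v-var 1) v-⊥₀
          v-pick false false = v-⊥₀

      Vars : Pred E 0ℓ
      Vars G = ∃ λ i → G ≡ var i

      eval-Vars : ∀ {G} → G ∈ Vars → designated (eval G) ≡ true
      eval-Vars (0           , refl) = refl
      eval-Vars (1           , refl) = refl
      eval-Vars (suc (suc _) , refl) = refl

      derive : ∀ {Γ C} → Entails K Γ C → Fibred (𝓑 K₁) (𝓑 K₂) Γ C
      derive = Equivalence.from (classical _ _)

    -- When the variables are true, `φ` has the left-hand side as its classical value, while the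
    -- right-hand side decides its designation in the model. If only the former is 1, the model
    -- refutes the inference from `Vars` to `φ`; if only the latter is, it refutes the one from
    -- `Vars` and `φ` to `⊥₀`.
    preserves-meet : ⟦ K₁ ⟧ c₁ (zipWith _∧_ xs ys) ≡ ⟦ K₁ ⟧ c₁ xs ∧ ⟦ K₁ ⟧ c₁ ys
    preserves-meet with ⟦ K₁ ⟧ c₁ (zipWith _∧_ xs ys) in meet | ⟦ K₁ ⟧ c₁ xs ∧ ⟦ K₁ ⟧ c₁ ys in both
    ... | true  | true  = refl
    ... | false | false = refl
    ... | true  | false = trans (sym (sound (derive {Vars} {φ}
      λ v val vΓ → trans (v-φ val (λ i → vΓ (i , refl))) meet) ρ eval-Vars)) (trans eval-φ both)
    ... | false | true = ⊥-elim (false≢true (trans (sym (cong designated eval-⊥₀))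
      (sound (derive {Vars ∪ (φ ≡_)} {⊥₀} λ v val vΓ →
        ⊥-elim (false≢true (trans (sym (trans (v-φ val (λ i → vΓ (inj₁ (i , refl)))) meet)) (vΓ (inj₂ refl)))))
        ρ [ eval-Vars , (λ { refl → trans eval-φ both }) ])))

  constant⇒topLike : (constant : ∀ c as bs → ⟦ K₂ ⟧ c as ≡ ⟦ K₂ ⟧ c bs) → ∀ c → TopLike K₂ c
  constant⇒topLike constant c₂ as with ⟦ K₂ ⟧ c₂ as in bottom
  ... | true  = refl
  ... | false = ⊥-elim (false≢true modus-ponens)
    where

    Value = Bool × Bool
    -- The right component reads every `K₂` symbol as 1, so `⊥₀` has value (0,1) and `imp` need not
    -- be implication there. Designation still obeys `K₂` because its connectives are constant.
    alg : (c : Symbol (Σ₁ ⊕ Σ₂)) → Vec Value (arity (Σ₁ ⊕ Σ₂) c) → Value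
    alg (inj₁ c) xs = ⟦ K₁ ⟧ c (map proj₁ xs) , ⟦ K₁ ⟧ c (map proj₂ xs)
    alg (inj₂ c) xs = ⟦ K₂ ⟧ c (map proj₁ xs) , true

    ρ : ℕ → Value
    ρ 0 = true , true
    ρ _ = true , false

    eval = extend alg ρ

    imp-function : Vec Bool 2 → Bool
    imp-function (x ∷ y ∷ []) = not x ∨ y
    imp : Formula (Σ₁ ⊕ Σ₂) (Fin 2)
    imp = proj₁ (complete (1 , imp-function))
    imp-correct = proj₂ (complete (1 , imp-function))

    ⊥₀ : E
    ⊥₀ = con (inj₂ c₂) (replicate _ (var 0))

    derive : ∀ {Γ C} → Entails K Γ C → Fibred (𝓑 K₁) (𝓑 K₂) Γ C
    derive = Equivalence.from (classical _ _)

    sound : ∀ {Γ C} → Fibred (𝓑 K₁) (𝓑 K₂) Γ C →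
            (∀ {G} → G ∈ Γ → proj₁ (eval G) ∧ proj₂ (eval G) ≡ true) → proj₁ (eval C) ∧ proj₂ (eval C) ≡ true
    sound d = Model.sound {K₁} {K₂} alg proj₁ proj₂ (λ _ _ → refl) (λ _ _ → refl)
      (λ c xs → trans (∧-comm _ true) (constant c _ _)) d ρ

    right-alg : (c : Symbol (Σ₁ ⊕ Σ₂)) → Vec Bool (arity (Σ₁ ⊕ Σ₂) c) → Bool
    right-alg (inj₁ c) = ⟦ K₁ ⟧ c
    right-alg (inj₂ c) = λ _ → true

    left-value : ∀ s t → proj₁ (eval (instantiate imp (s ∷ t ∷ []))) ≡ not (proj₁ (eval s)) ∨ proj₁ (eval t)
    left-value s t = trans (cong proj₁ (extend-extend alg ρ _ imp))
      (trans (extend-fusion proj₁ (λ { (inj₁ c) _ → refl ; (inj₂ c) _ → refl })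
        (λ { zero → refl ; (suc zero) → refl }) imp) (imp-correct (proj₁ (eval s) ∷ proj₁ (eval t) ∷ [])))

    right-value : ∀ s t → proj₂ (eval (instantiate imp (s ∷ t ∷ []))) ≡
                          extend right-alg (lookup (proj₂ (eval s) ∷ proj₂ (eval t) ∷ [])) imp
    right-value s t = trans (cong proj₂ (extend-extend alg ρ _ imp))
      (extend-fusion proj₂ (λ { (inj₁ c) _ → refl ; (inj₂ c) _ → refl })
        (λ { zero → refl ; (suc zero) → refl }) imp)

    v-imp : ∀ {v} → IsValuation K v → ∀ s t → v (instantiate imp (s ∷ t ∷ [])) ≡ not (v s) ∨ v t
    v-imp val s t = trans (valuation-instantiate K val imp (s ∷ t ∷ [])) (imp-correct _)

    ex-falso : proj₂ (eval (instantiate imp (⊥₀ ∷ var 1 ∷ []))) ≡ true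
    ex-falso = proj₂-∧ (sound (derive {λ _ → ⊥} λ v val _ → trans (v-imp val ⊥₀ (var 1))
        (cong (λ b → not b ∨ v (var 1)) (trans (val _ _) (trans (constant c₂ _ as) bottom)))) λ ())
      where
      proj₂-∧ : ∀ {x y} → x ∧ y ≡ true → y ≡ true
      proj₂-∧ {true} e = e

    modus-ponens : false ≡ true
    modus-ponens = sound (derive {(var 0 ≡_) ∪ (instantiate imp (var 0 ∷ var 1 ∷ []) ≡_)} {var 1}
        λ v val vΓ → detach (vΓ (inj₁ refl)) (trans (sym (v-imp val (var 0) (var 1))) (vΓ (inj₂ refl))))
      -- On the right `⊥₀` and `var 0` are both 1, so the second premise inherits its right value
      -- from `ex-falso`.
      [ (λ { refl → refl }) , (λ { refl → cong₂ _∧_ (left-value (var 0) (var 1))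
          (trans (right-value (var 0) (var 1)) (trans (sym (right-value ⊥₀ (var 1))) ex-falso)) }) ]
      where
      detach : ∀ {x y} → x ≡ true → not x ∨ y ≡ true → y ≡ true
      detach refl e = e

-- Clones

record Clone : Set₁ where
  field
    Has  : (Vec Bool n → Bool) → Set
    resp : {f g : Vec Bool n → Bool} → f ≗ g → Has f → Has g
    proj : (i : Fin n) → Has (λ xs → lookup xs i)
    comp : {f : Vec Bool n → Bool} {gs : Vec (Vec Bool m → Bool) n} →
           Has f → All Has gs → Has (λ xs → f (map (λ g → g xs) gs))

  comp-tabulate : {f : Vec Bool n → Bool} {g : Fin n → Vec Bool m → Bool} →
                  Has f → (∀ i → Has (g i)) → Has (λ xs → f (tabulate (λ i → g i xs)))
  comp-tabulate {f = f} {g} hf hg =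
    resp (λ xs → cong f (sym (tabulate-∘ (λ h → h xs) g))) (comp hf (tabulate⁺ hg))

  comp-head : {f : Vec Bool (suc n) → Bool} {g : Vec Bool n → Bool} →
              Has f → Has g → Has (λ xs → f (g xs ∷ xs))
  comp-head {f = f} {g} hf hg = resp
    (λ xs → cong (λ ys → f (g xs ∷ ys)) (trans (sym (tabulate-∘ _ _)) (tabulate∘lookup xs)))
    (comp hf (hg ∷ tabulate⁺ {f = λ i xs → lookup xs i} proj))

  comp-tail : {f : Vec Bool n → Bool} → Has f → Has {suc n} (λ { (x ∷ xs) → f xs })
  comp-tail {f = f} hf = resp (λ { (x ∷ xs) → cong f (tabulate∘lookup xs) })
    (comp-tabulate {g = λ i xs → lookup xs (suc i)} hf (λ i → proj (suc i)))

  module Nonimplies (hn : Has nonimplies) where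

    nimp : {f g : Vec Bool n → Bool} → Has f → Has g → Has (λ xs → f xs ∧ not (g xs))
    nimp hf hg = comp hn (hf ∷ hg ∷ [])

    and : {f g : Vec Bool n → Bool} → Has f → Has g → Has (λ xs → f xs ∧ g xs)
    and {f = f} {g} hf hg = resp (λ xs → ∧-∧-not (f xs) (g xs)) (nimp hf (nimp hf hg))
      where
      ∧-∧-not : ∀ x y → x ∧ not (x ∧ not y) ≡ x ∧ y
      ∧-∧-not false y     = refl
      ∧-∧-not true  false = refl
      ∧-∧-not true  true  = refl

    -- With the constant 1, negation is `1 ↛ x`; induction on the arity then uses the Shannon
    -- expansion in the first argument.
    all-functions : (∀ {n} → Has {n} (λ _ → true)) → (g : Vec Bool n → Bool) → Has g
    all-functions {zero} h1 g with g [] in e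
    ... | true  = resp (λ { [] → sym e }) h1
    ... | false = resp (λ { [] → sym e }) (nimp h1 h1)
    all-functions {suc n} h1 g = resp (λ { (x ∷ xs) → cases x xs })
      (neg (nimp (neg (nimp (proj zero) (neg (branch true)))) (nimp (neg (proj zero)) (neg (branch false)))))
      where
      neg : {f : Vec Bool (suc n) → Bool} → Has f → Has (λ xs → not (f xs))
      neg = nimp h1
      branch : ∀ x → Has {suc n} (λ { (_ ∷ xs) → g (x ∷ xs) })
      branch x = resp (λ { (_ ∷ _) → refl }) (comp-tail (all-functions h1 (λ xs → g (x ∷ xs))))
      cases : ∀ x xs →
        not (not (x ∧ not (not (g (true ∷ xs)))) ∧ not (not x ∧ not (not (g (false ∷ xs))))) ≡ g (x ∷ xs)
      cases true xs with g (true ∷ xs)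
      ... | true  = refl
      ... | false = refl
      cases false xs with g (false ∷ xs)
      ... | true  = refl
      ... | false = refl

open Clone

module _ (K : Connectives) where

  termClone : Clone
  termClone = record
    { Has  = λ f → ∃ λ φ → termFunction K φ ≗ f
    ; resp = λ { e (φ , φ≗f) → φ , λ xs → trans (φ≗f xs) (e xs) }
    ; proj = λ i → var i , λ xs → refl
    ; comp = λ { {f = f} (φ , φ≗f) hgs → extend con (lookup (All.reduce proj₁ hgs)) φ , λ xs →
        trans (trans (extend-extend ⟦ K ⟧ (lookup xs) _ φ)
          (extend-fusion id (λ c as → cong (⟦ K ⟧ c) (sym (map-id as)))
            (λ i → sym (lookup-map i _ (All.reduce proj₁ hgs))) φ))
          (trans (φ≗f _) (cong f (values hgs xs))) }
    }
    where
    values : {gs : Vec (Vec Bool m → Bool) n} (hgs : All (λ f → ∃ λ φ → termFunction K φ ≗ f) gs) → ∀ xs →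
             map (λ ψ → termFunction K ψ xs) (All.reduce proj₁ hgs) ≡ map (λ g → g xs) gs
    values []              xs = refl
    values ((_ , e) ∷ hgs) xs = cong₂ _∷_ (e xs) (values hgs xs)

  connective∈termClone : ∀ c → Has termClone (⟦ K ⟧ c)
  connective∈termClone c = con c (tabulate var) , λ xs → cong (⟦ K ⟧ c)
    (trans (extends≡map _ _ (tabulate var)) (trans (sym (tabulate-∘ _ var)) (tabulate∘lookup xs)))

  module _ (C : Clone) (has : ∀ c → Has C (⟦ K ⟧ c)) where

    termFunction∈clone  : (φ : Formula (signature K) (Fin n)) → Has C (termFunction K φ)
    termFunctions∈clone : (φs : Vec (Formula (signature K) (Fin n)) m) →
                          All (Has C) (map (termFunction K) φs)
    termFunction∈clone (var i)    = proj C i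
    termFunction∈clone (con c ts) = resp C
      (λ xs → cong (⟦ K ⟧ c) (trans (sym (map-∘ _ _ ts)) (sym (extends≡map _ _ ts))))
      (comp C (has c) (termFunctions∈clone ts))
    termFunctions∈clone []       = []
    termFunctions∈clone (φ ∷ φs) = termFunction∈clone φ ∷ termFunctions∈clone φs

    termClone⊆ : {f : Vec Bool n → Bool} → Has termClone f → Has C f
    termClone⊆ (φ , φ≗f) = resp C φ≗f (termFunction∈clone φ)

-- The clone generated by `C` and the constant 1, which enters as a frozen first argument.
relative : Clone → Clone
relative C = record
  { Has  = λ g → ∃ λ t → Has C t × ∀ xs → t (true ∷ xs) ≡ g xs
  ; resp = λ { e (t , ht , t≡) → t , ht , λ xs → trans (t≡ xs) (e xs) }
  ; proj = λ i → _ , proj C (suc i) , λ xs → refl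
  ; comp = λ { {f = f} (t , ht , t≡) hgs →
      _ , comp C ht (proj C zero ∷ lifted hgs) , λ xs → trans (t≡ _) (cong f (values hgs xs)) }
  }
  where
  Rel : (Vec Bool n → Bool) → Set
  Rel g = ∃ λ t → Has C t × ∀ xs → t (true ∷ xs) ≡ g xs
  lifted : {gs : Vec (Vec Bool m → Bool) n} (hgs : All Rel gs) → All (Has C) (All.reduce proj₁ hgs)
  lifted []                   = []
  lifted ((t , ht , _) ∷ hgs) = ht ∷ lifted hgs
  values : {gs : Vec (Vec Bool m → Bool) n} (hgs : All Rel gs) → ∀ xs →
           map (λ g → g (true ∷ xs)) (All.reduce proj₁ hgs) ≡ map (λ g → g xs) gs
  values []                   xs = refl
  values ((_ , _ , t≡) ∷ hgs) xs = cong₂ _∷_ (t≡ xs) (values hgs xs)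

RelativelyComplete : Clone → Set
RelativelyComplete C = ∀ {n} (g : Vec Bool (suc n) → Bool) → Has (relative C) g

relativelyComplete : ∀ C → Has (relative C) nonimplies → RelativelyComplete C
relativelyComplete C hn =
  Nonimplies.all-functions (relative C) hn (head , resp C (λ { (x ∷ xs) → refl }) (proj C zero) , λ xs → refl)

nonimplies-relative : ∀ C → Has C nonimplies → Has (relative C) nonimplies
nonimplies-relative C hn = _ , comp-tail C hn , λ { (x ∷ y ∷ []) → refl }

replicate-tabulate : ∀ n (x : A) → tabulate {n = n} (λ _ → x) ≡ replicate n x
replicate-tabulate zero    x = refl
replicate-tabulate (suc n) x = cong (x ∷_) (replicate-tabulate n x)

-- Some closed properties

SelfDual : (Vec Bool n → Bool) → Set
SelfDual f = ∀ xs → f (map not xs) ≡ not (f xs)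

selfDualClone : Clone
selfDualClone = record
  { Has  = SelfDual
  ; resp = λ e sd xs → trans (sym (e _)) (trans (sd xs) (cong not (e xs)))
  ; proj = λ i xs → lookup-map i not xs
  ; comp = λ {_} {_} {f} sd sds xs → trans (cong f (values sds xs)) (sd _)
  }
  where
  values : {gs : Vec (Vec Bool m → Bool) n} → All SelfDual gs → ∀ xs →
           map (λ g → g (map not xs)) gs ≡ map not (map (λ g → g xs) gs)
  values []         xs = refl
  values (sd ∷ sds) xs = cong₂ _∷_ (sd xs) (values sds xs)

ZeroPreserving : (Vec Bool n → Bool) → Set
ZeroPreserving {n} f = f (replicate n false) ≡ false

zeroPreservingClone : Clone
zeroPreservingClone = record
  { Has  = ZeroPreserving
  ; resp = λ e z → trans (sym (e _)) z
  ; proj = λ i → lookup-replicate i false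
  ; comp = λ {_} {_} {f} z zs → trans (cong f (values zs)) z
  }
  where
  values : {gs : Vec (Vec Bool m → Bool) n} → All ZeroPreserving gs →
           map (λ g → g (replicate m false)) gs ≡ replicate n false
  values []       = refl
  values (z ∷ zs) = cong₂ _∷_ z (values zs)

-- `f` lies below a projection. In positive arity this characterises `𝕋₀∞`.
Bounded : (Vec Bool n → Bool) → Set
Bounded f = ∃ λ i → ∀ xs → f xs ≡ true → lookup xs i ≡ true

boundedClone : Clone
boundedClone = record
  { Has  = Bounded
  ; resp = λ { e (i , b) → i , λ xs fx → b xs (trans (e xs) fx) }
  ; proj = λ i → i , λ xs e → e
  ; comp = λ { {gs = gs} (i , b) bs → proj₁ (lookup⁺ bs i) , λ xs fx →
      proj₂ (lookup⁺ bs i) xs (trans (sym (lookup-map i _ gs)) (b _ fx)) }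
  }

meetClone : Clone
meetClone = record
  { Has  = PreservesMeets
  ; resp = λ e p xs ys → trans (sym (e _)) (trans (p xs ys) (cong₂ _∧_ (e xs) (e ys)))
  ; proj = λ i xs ys → lookup-zipWith _∧_ i xs ys
  ; comp = λ {_} {_} {f} p ps xs ys → trans (cong f (values ps xs ys)) (p _ _)
  }
  where
  values : {gs : Vec (Vec Bool m → Bool) n} → All PreservesMeets gs → ∀ xs ys →
           map (λ g → g (zipWith _∧_ xs ys)) gs ≡ zipWith _∧_ (map (λ g → g xs) gs) (map (λ g → g ys) gs)
  values []       xs ys = refl
  values (p ∷ ps) xs ys = cong₂ _∷_ (p xs ys) (values ps xs ys)

-- Clones that the constant 1 makes complete

-- Identifying the parameter of `t` with the first argument gives a function that agrees with `g`
-- wherever this argument is 1; self-duality of both settles the other half.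
selfDual-has : ∀ C → RelativelyComplete C → (∀ {n} {f : Vec Bool n → Bool} → Has C f → SelfDual f) →
               {g : Vec Bool (suc n) → Bool} → SelfDual g → Has C g
selfDual-has C rc selfDual {g} g-sd with rc g
... | t , ht , t≡ = resp C (λ { (true ∷ xs) → t≡ (true ∷ xs) ; (false ∷ xs) → at-false xs }) hs
  where
  s : Vec Bool _ → Bool
  s xs = t (lookup xs zero ∷ xs)
  hs : Has C s
  hs = comp-head C ht (proj C zero)
  not-not : (xs : Vec Bool n) → map not (map not xs) ≡ xs
  not-not xs = trans (sym (map-∘ not not xs)) (trans (map-cong not-involutive xs) (map-id xs))
  at-false : ∀ xs → s (false ∷ xs) ≡ g (false ∷ xs)
  at-false xs = trans (cong (λ ys → s (false ∷ ys)) (sym (not-not xs)))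
    (trans (selfDual hs (true ∷ map not xs)) (trans (cong not (t≡ (true ∷ map not xs)))
      (trans (sym (g-sd (true ∷ map not xs))) (cong (λ ys → g (false ∷ ys)) (not-not xs)))))

module ZeroPreservingClone (C : Clone) (rc : RelativelyComplete C)
  (zeroPreserving : ∀ {n} {f : Vec Bool n → Bool} → Has C f → ZeroPreserving f) where

  -- These are all 0-preserving functions t with t(1,x,y) = x ∧ ¬ y.
  private
    extension : Bool → Bool → Bool → Vec Bool 3 → Bool
    extension a b c (true  ∷ x     ∷ y     ∷ []) = x ∧ not y
    extension a b c (false ∷ false ∷ false ∷ []) = false
    extension a b c (false ∷ false ∷ true  ∷ []) = a
    extension a b c (false ∷ true  ∷ false ∷ []) = b
    extension a b c (false ∷ true  ∷ true  ∷ []) = c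

    extension⇒nonimplies : ∀ a b c → Has C (extension a b c) → Has C nonimplies
    extension⇒nonimplies = cases
      where
      table : {f : Vec Bool 2 → Bool} → f (false ∷ false ∷ []) ≡ false → f (false ∷ true ∷ []) ≡ false →
              f (true ∷ false ∷ []) ≡ true → f (true ∷ true ∷ []) ≡ false → f ≗ nonimplies
      table e₀₀ e₀₁ e₁₀ e₁₁ (false ∷ false ∷ []) = e₀₀
      table e₀₀ e₀₁ e₁₀ e₁₁ (false ∷ true  ∷ []) = e₀₁
      table e₀₀ e₀₁ e₁₀ e₁₁ (true  ∷ false ∷ []) = e₁₀
      table e₀₀ e₀₁ e₁₀ e₁₁ (true  ∷ true  ∷ []) = e₁₁
      x : Has C {2} (λ xs → lookup xs zero)
      x = proj C zero
      y : Has C {2} (λ xs → lookup xs (suc zero))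
      y = proj C (suc zero)
      -- t(x,x,x) is 0 and, when a = 1, t(x,x,y) is the exclusive or of x and y.
      cases : ∀ a b c → Has C (extension a b c) → Has C nonimplies
      cases false b c ht = resp C (table refl refl refl refl) (comp C ht (x ∷ x ∷ y ∷ []))
      cases true b false ht = resp C (table refl refl refl refl)
        (comp C ht (comp C ht (x ∷ x ∷ y ∷ []) ∷ x ∷ y ∷ []))
      cases true true true ht = resp C (table refl refl refl refl)
        (comp C ht (comp C ht (comp C ht (x ∷ x ∷ x ∷ []) ∷ x ∷ y ∷ []) ∷ x ∷ y ∷ []))
      cases true false true ht = resp C (table refl refl refl refl)
        (comp C ht (x ∷ x ∷ comp C ht (y ∷ x ∷ comp C ht (x ∷ x ∷ x ∷ []) ∷ []) ∷ []))

  -- A witness for `↛` over the constant 1 is known except at three points with first argument 0,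
  -- and each of the eight possibilities yields `↛` itself.
  nonimplies∈ : Has C nonimplies
  nonimplies∈ with rc nonimplies
  ... | t , ht , t≡ = extension⇒nonimplies _ _ _ (resp C t≗extension ht)
    where
    t≗extension : t ≗ extension (t (false ∷ false ∷ true ∷ [])) (t (false ∷ true ∷ false ∷ []))
                                (t (false ∷ true ∷ true ∷ []))
    t≗extension (true  ∷ x     ∷ y     ∷ []) = t≡ (x ∷ y ∷ [])
    t≗extension (false ∷ false ∷ false ∷ []) = zeroPreserving ht
    t≗extension (false ∷ false ∷ true  ∷ []) = refl
    t≗extension (false ∷ true  ∷ false ∷ []) = refl
    t≗extension (false ∷ true  ∷ true  ∷ []) = refl

  open Nonimplies C nonimplies∈

  -- The function `t(f(x),x) ∧ f(x)` equals `g` where `f` is 1, and elsewhere both are 0.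
  down-closed : {f g : Vec Bool (suc n) → Bool} → Has C f → (∀ xs → g xs ≡ true → f xs ≡ true) → Has C g
  down-closed {f = f} {g} hf g≤f with rc g
  ... | t , ht , t≡ = resp C below (and (comp-head C ht hf) hf)
    where
    below : ∀ xs → t (f xs ∷ xs) ∧ f xs ≡ g xs
    below xs with f xs in fx | g xs in gx
    ... | true  | b     = trans (∧-comm _ true) (trans (t≡ xs) gx)
    ... | false | false = ∧-comm _ false
    ... | false | true  = ⊥-elim (false≢true (trans (sym fx) (g≤f xs gx)))

  bounded∈ : {g : Vec Bool (suc n) → Bool} → Bounded g → Has C g
  bounded∈ (i , b) = down-closed (proj C i) b

-- Threshold functions

count : Vec Bool n → ℕ
count = countᵇ id

threshold-true : ∀ {n k} (xs : Vec Bool n) → threshold n k xs ≡ true → k ≤ count xs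
threshold-true {k = k} xs e = ≤ᵇ⇒≤ k (count xs) (Equivalence.from T-≡ e)

true-threshold : ∀ {n k} (xs : Vec Bool n) → k ≤ count xs → threshold n k xs ≡ true
true-threshold xs k≤ = Equivalence.to T-≡ (≤⇒≤ᵇ k≤)

count≤ : (xs : Vec Bool n) → count xs ≤ n
count≤ []           = z≤n
count≤ (true  ∷ xs) = s≤s (count≤ xs)
count≤ (false ∷ xs) = m≤n⇒m≤1+n (count≤ xs)

full-count : (xs : Vec Bool n) → n ≤ count xs → ∀ i → lookup xs i ≡ true
full-count (true  ∷ xs) n≤        zero    = refl
full-count (true  ∷ xs) (s≤s n≤)  (suc i) = full-count xs n≤ i
full-count (false ∷ xs) n≤        i       = ⊥-elim (1+n≰n (≤-trans n≤ (count≤ xs)))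

count-full : (xs : Vec Bool n) → (∀ i → lookup xs i ≡ true) → n ≤ count xs
count-full []           _ = z≤n
count-full (true  ∷ xs) e = s≤s (count-full xs (e ∘ suc))
count-full (false ∷ xs) e = ⊥-elim (false≢true (e zero))

count-but-one : (xs : Vec Bool (suc n)) (j : Fin (suc n)) → (∀ i → i ≢ j → lookup xs i ≡ true) →
                n ≤ count xs
count-but-one (true  ∷ xs) zero e = m≤n⇒m≤1+n (count-full xs (λ i → e (suc i) λ ()))
count-but-one (false ∷ xs) zero e = count-full xs (λ i → e (suc i) λ ())
count-but-one {suc n} (true  ∷ xs) (suc j) e =
  s≤s (count-but-one xs j (λ i i≢j → e (suc i) (i≢j ∘ suc-injective)))
count-but-one {suc n} (false ∷ xs) (suc j) e = ⊥-elim (false≢true (e zero λ ()))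

firstFalse : Vec Bool (suc n) → Fin (suc n)
firstFalse         (false ∷ xs) = zero
-- A default: the all-true vector is sent to its last index.
firstFalse {zero}  (true  ∷ xs) = zero
firstFalse {suc n} (true  ∷ xs) = suc (firstFalse xs)

firstFalse-unique : (xs : Vec Bool (suc n)) (i : Fin (suc n)) → n ≤ count xs → lookup xs i ≡ false →
                    firstFalse xs ≡ i
firstFalse-unique         (false ∷ xs) zero    _        _ = refl
firstFalse-unique         (false ∷ xs) (suc i) n≤       e =
  ⊥-elim (false≢true (trans (sym e) (full-count xs n≤ i)))
firstFalse-unique {suc n} (true  ∷ xs) (suc i) (s≤s n≤) e = cong suc (firstFalse-unique xs i n≤ e)

-- Intersecting functions

-- The set where `f` is 1, read as a family of sets of coordinates, is k-wise intersecting;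
-- repetitions are allowed.
Intersecting : ℕ → (Vec Bool n → Bool) → Set
Intersecting {n} k f = (ps : Vec (Vec Bool n) k) → All (λ p → f p ≡ true) ps →
                       ∃ λ i → All (λ p → lookup p i ≡ true) ps

all-true? : (h : A → Bool) (xs : Vec A n) → All (λ x → h x ≡ true) xs ⊎ ∃ λ i → h (lookup xs i) ≡ false
all-true? h []       = inj₁ []
all-true? h (x ∷ xs) with h x in hx | all-true? h xs
... | false | _            = inj₂ (zero , hx)
... | true  | inj₁ hxs     = inj₁ (hx ∷ hxs)
... | true  | inj₂ (i , e) = inj₂ (suc i , e)

All-removeAt : {P : A → Set} (xs : Vec A (suc n)) → All P xs → ∀ i → All P (removeAt xs i)
All-removeAt (x ∷ xs)         (px ∷ pxs) zero    = pxs
All-removeAt (x ∷ xs@(_ ∷ _)) (px ∷ pxs) (suc i) = px ∷ All-removeAt xs pxs i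

allVectors : ∀ n → List (Vec Bool n)
allVectors zero    = [] List.∷ List.[]
allVectors (suc n) = List.map (true ∷_) (allVectors n) List.++ List.map (false ∷_) (allVectors n)

∈-allVectors : (xs : Vec Bool n) → xs ∈ˡ allVectors n
∈-allVectors []           = here refl
∈-allVectors (true  ∷ xs) = ∈-++⁺ˡ (∈-map⁺ (true ∷_) (∈-allVectors xs))
∈-allVectors (false ∷ xs) = ∈-++⁺ʳ _ (∈-map⁺ (false ∷_) (∈-allVectors xs))

module _ (C : Clone) (rc : RelativelyComplete C)
  (zeroPreserving : ∀ {n} {f : Vec Bool n → Bool} → Has C f → ZeroPreserving f) where

  open ZeroPreservingClone C rc zeroPreserving

  -- Where `θ` is 1, at most one coordinate of `ys` is false, and the functions `h j` assemble the
  -- point of `ps` with that index; elsewhere they assemble the zero vector. For each `j` some point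
  -- of `ps` vanishes at `j`, and its index gives a projection above `h j`.
  threshold∈ : ∀ {k} {f : Vec Bool (suc n) → Bool} → Has C f →
    (ps : Vec (Vec Bool (suc n)) (suc k)) → All (λ p → f p ≡ true) ps →
    ¬ (∃ λ i → All (λ p → lookup p i ≡ true) ps) → Has C (threshold (suc k) k)
  threshold∈ {n} {k} {f} hf ps fps disjoint =
    resp C value (comp-tabulate C {g = h} hf (λ j → bounded∈ (h-bounded j)))
    where
    θ = threshold (suc k) k
    h : Fin (suc n) → Vec Bool (suc k) → Bool
    h j ys = θ ys ∧ lookup (lookup ps (firstFalse ys)) j
    h-bounded : ∀ j → Bounded (h j)
    h-bounded j with all-true? (λ p → lookup p j) ps
    ... | inj₁ all-j   = ⊥-elim (disjoint (j , all-j))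
    ... | inj₂ (i , e) = i , λ ys hys → at-most ys hys
      where
      at-most : ∀ ys → h j ys ≡ true → lookup ys i ≡ true
      at-most ys hys with θ ys in θys | lookup ys i in ysi
      ... | _    | true  = refl
      ... | true | false = ⊥-elim (false≢true (trans (sym e) (trans
        (cong (λ m → lookup (lookup ps m) j) (sym (firstFalse-unique ys i (threshold-true ys θys) ysi))) hys)))
    value : (λ ys → f (tabulate (λ j → h j ys))) ≗ θ
    value ys with θ ys
    ... | true  = trans (cong f (tabulate∘lookup (lookup ps (firstFalse ys)))) (lookup⁺ fps _)
    ... | false = trans (cong f (replicate-tabulate (suc n) false)) (zeroPreserving hf)

  module _ {k : ℕ} (θ∈ : Has C (threshold (suc k) k)) where

    -- Near unanimity: omitting the points q, p₁, …, p_k one at a time gives functions g₀, …, g_k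
    -- of which at most one is 0 at any point to be covered.
    cover : {f : Vec Bool (suc n) → Bool} → Intersecting k f → (qs : List (Vec Bool (suc n))) →
            (ps : Vec (Vec Bool (suc n)) k) → All (λ p → f p ≡ true) ps →
            ∃ λ g → Has C g × All (λ p → g p ≡ true) ps × (∀ {q} → q ∈ˡ qs → f q ≡ true → g q ≡ true)
    cover int List.[] ps fps with int ps fps
    ... | i , psi = _ , proj C i , psi , λ ()
    cover {f = f} int (q List.∷ qs) ps fps with f q in fq
    ... | false with cover int qs ps fps
    ...   | g , hg , gps , gqs = g , hg , gps , λ
      { (here refl)  e → ⊥-elim (false≢true (trans (sym fq) e)) ; (there q∈) e → gqs q∈ e }
    cover {n} {f = f} int (q List.∷ qs) ps fps | true =
      G , comp-tabulate C {g = g} θ∈ (λ i → proj₁ (proj₂ (ih i))) ,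
      All.tail G-points , λ { (here refl) _ → All.head G-points
                            ; (there {x = q} q∈) e → G-true _ zero λ i _ → proj₂ (proj₂ (proj₂ (ih i))) q∈ e }
      where
      points : Vec (Vec Bool (suc n)) (suc k)
      points = q ∷ ps
      ih : (i : Fin (suc k)) → _
      ih i = cover int qs (removeAt points i) (All-removeAt points (fq ∷ fps) i)
      g : Fin (suc k) → Vec Bool (suc n) → Bool
      g i = proj₁ (ih i)
      G : Vec Bool (suc n) → Bool
      G xs = threshold (suc k) k (tabulate (λ i → g i xs))
      G-true : ∀ xs j → (∀ i → i ≢ j → g i xs ≡ true) → G xs ≡ true
      G-true xs j e = true-threshold (tabulate (λ i → g i xs)) (count-but-one (tabulate (λ i → g i xs)) j
        (λ i i≢j → trans (lookup∘tabulate (λ i → g i xs) i) (e i i≢j)))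
      G-points : All (λ p → G p ≡ true) points
      G-points = lookup⁻ λ j → G-true _ j λ i i≢j →
        trans (cong (g i) (sym (removeAt-punchOut points i≢j)))
          (lookup⁺ (proj₁ (proj₂ (proj₂ (ih i)))) (punchOut i≢j))

    -- Covering every point where `f` is 1 gives a function of `C` above `f`. The `k` points needed
    -- at the start are copies of a single one.
    intersecting∈ : (∀ {ℓ} → ExcludedMiddle ℓ) → {f : Vec Bool (suc n) → Bool} → Intersecting k f → Has C f
    intersecting∈ em {f} int with em {P = ∃ λ p → f p ≡ true}
    ... | no  empty    = bounded∈ (zero , λ p fp → ⊥-elim (empty (p , fp)))
    ... | yes (p , fp) with cover int (allVectors _) (replicate k p) (lookup⁻ λ i →
                              trans (cong f (lookup-replicate i p)) fp)
    ...   | g , hg , _ , f≤g = down-closed hg (λ q → f≤g (∈-allVectors q))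

-- The named clones

private
  K𝔻 K∞ : Connectives
  K𝔻 = ⟨ (3 , threshold 3 2) ∷ (1 , negation) ∷ [] ⟩
  K∞ = ⟨ (2 , nonimplies) ∷ [] ⟩
  K₀ : ℕ → Connectives
  K₀ k = ⟨ (suc k , threshold (suc k) k) ∷ (2 , nonimplies) ∷ [] ⟩

𝔻-selfDual : {f : Vec Bool n → Bool} → Has (termClone K𝔻) f → SelfDual f
𝔻-selfDual = termClone⊆ K𝔻 selfDualClone λ
  { zero (true  ∷ true  ∷ true  ∷ []) → refl ; zero (true  ∷ true  ∷ false ∷ []) → refl
  ; zero (true  ∷ false ∷ true  ∷ []) → refl ; zero (true  ∷ false ∷ false ∷ []) → refl
  ; zero (false ∷ true  ∷ true  ∷ []) → refl ; zero (false ∷ true  ∷ false ∷ []) → refl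
  ; zero (false ∷ false ∷ true  ∷ []) → refl ; zero (false ∷ false ∷ false ∷ []) → refl
  ; (suc zero) (x ∷ []) → refl }

-- Majority with one argument fixed to 0 is conjunction, so the majority of `x`, `¬ y` and `¬ 1` is
-- `x ↛ y`.
𝔻-relativelyComplete : RelativelyComplete (termClone K𝔻)
𝔻-relativelyComplete = relativelyComplete (termClone K𝔻)
  (_ , comp C (connective∈termClone K𝔻 zero)
         (proj C (suc zero) ∷ neg (suc (suc zero)) ∷ neg zero ∷ []) ,
   λ { (true ∷ true ∷ []) → refl ; (true ∷ false ∷ []) → refl
     ; (false ∷ true ∷ []) → refl ; (false ∷ false ∷ []) → refl })
  where
  C = termClone K𝔻
  neg : (i : Fin 3) → Has C (λ xs → not (lookup xs i))
  neg i = comp C (connective∈termClone K𝔻 (suc zero)) (proj C i ∷ [])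

nonimplies-bounded : Bounded nonimplies
nonimplies-bounded = zero , λ { (true ∷ _ ∷ []) _ → refl }

𝕋₀∞-bounded : {f : Vec Bool n → Bool} → Has (termClone K∞) f → Bounded f
𝕋₀∞-bounded = termClone⊆ K∞ boundedClone λ { zero → nonimplies-bounded }

bounded-zeroPreserving : {f : Vec Bool n → Bool} → Bounded f → ZeroPreserving f
bounded-zeroPreserving {n} {f} (i , b) with f (replicate n false) in e
... | false = refl
... | true  = ⊥-elim (false≢true (trans (sym (lookup-replicate i false)) (b _ e)))

-- The index is a successor because `threshold 1 0` is constantly 1.
𝕋₀-zeroPreserving : ∀ {k} {f : Vec Bool n → Bool} → Has (termClone (K₀ (suc k))) f → ZeroPreserving f
𝕋₀-zeroPreserving {k = k} = termClone⊆ (K₀ (suc k)) zeroPreservingClone λ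
  { zero → cong (suc k ≤ᵇ_) (count-false k) ; (suc zero) → refl }
  where
  count-false : ∀ n → count (replicate n false) ≡ 0
  count-false zero    = refl
  count-false (suc n) = count-false n

-- Classification of the incomplete clones that the constant 1 completes

module _ (em : ∀ {ℓ} → ExcludedMiddle ℓ) (K : Connectives)
         (rc : RelativelyComplete (termClone K)) (incomplete : ¬ FunctionallyComplete K) where

  private
    C = termClone K

  ¬-true∈ : ¬ Has C {1} (λ _ → true)
  ¬-true∈ h = incomplete λ { (n , g) → let (t , ht , t≡) = rc g in
    resp C t≡ (comp-head C ht (comp C h (proj C zero ∷ []))) }

  -- If `f` agrees at some point and its complement, feeding it `y` or `¬ y` in each place gives a
  -- unary constant and hence, negated if need be, the excluded constant 1. So both clones consist
  -- of self-dual functions, and `selfDual-has` gives each inclusion.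
  negation⇒𝔻 : Has C negation → 𝓒 K ≐ 𝔻
  negation⇒𝔻 hneg =
    (λ h → selfDual-has (termClone K𝔻) 𝔻-relativelyComplete 𝔻-selfDual (selfDual h)) ,
    (λ h → selfDual-has C rc selfDual (𝔻-selfDual h))
    where
    literal : Bool → Bool → Bool
    literal x y = if x then y else not y

    literal∈ : ∀ x → Has C {1} (λ ys → literal x (lookup ys zero))
    literal∈ true  = proj C zero
    literal∈ false = resp C (λ { (_ ∷ []) → refl }) hneg

    selfDual : {f : Vec Bool n → Bool} → Has C f → SelfDual f
    selfDual {n} {f} hf xs = by-cases _ _ refl refl
      where
      diagonal : Vec Bool 1 → Bool
      diagonal ys = f (tabulate (λ i → literal (lookup xs i) (lookup ys zero)))
      diagonal∈ : Has C diagonal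
      diagonal∈ = comp-tabulate C hf (λ i → literal∈ (lookup xs i))
      diagonal-true : diagonal (true ∷ []) ≡ f xs
      diagonal-true = cong f (trans (tabulate-cong (λ i → literal-true (lookup xs i))) (tabulate∘lookup xs))
        where
        literal-true : ∀ x → literal x true ≡ x
        literal-true true  = refl
        literal-true false = refl
      diagonal-false : diagonal (false ∷ []) ≡ f (map not xs)
      diagonal-false = cong f (trans (tabulate-cong (λ i → trans (literal-false (lookup xs i))
        (sym (lookup-map i not xs)))) (tabulate∘lookup (map not xs)))
        where
        literal-false : ∀ x → literal x false ≡ not x
        literal-false true  = refl
        literal-false false = refl
      by-cases : ∀ a b → f xs ≡ a → f (map not xs) ≡ b → f (map not xs) ≡ not (f xs)
      by-cases true  false e e′ = trans e′ (cong not (sym e))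
      by-cases false true  e e′ = trans e′ (cong not (sym e))
      by-cases true  true  e e′ = ⊥-elim (¬-true∈ (resp C
        (λ { (true ∷ []) → trans diagonal-true e ; (false ∷ []) → trans diagonal-false e′ }) diagonal∈))
      by-cases false false e e′ = ⊥-elim (¬-true∈ (resp C
        (λ { (true ∷ []) → cong not (trans diagonal-true e)
           ; (false ∷ []) → cong not (trans diagonal-false e′) })
        (comp C hneg (diagonal∈ ∷ []))))

  -- Identifying all arguments leaves a unary function with value 1 at 0. It is not constant, so it
  -- is negation.
  not-zeroPreserving⇒negation : {f : Vec Bool n → Bool} →
    Has C f → f (replicate n false) ≡ true → Has C negation
  not-zeroPreserving⇒negation {n} {f} hf f0 = by-cases _ refl
    where
    unary∈ : Has C {1} (λ ys → f (tabulate (λ _ → lookup ys zero)))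
    unary∈ = comp-tabulate C hf (λ _ → proj C zero)
    at-false : f (tabulate (λ _ → false)) ≡ true
    at-false = trans (cong f (replicate-tabulate n false)) f0
    by-cases : ∀ b → f (tabulate (λ _ → true)) ≡ b → Has C negation
    by-cases false e = resp C (λ { (true ∷ []) → e ; (false ∷ []) → at-false }) unary∈
    by-cases true  e = ⊥-elim (¬-true∈ (resp C (λ { (true ∷ []) → e ; (false ∷ []) → at-false }) unary∈))

  module _ (zeroPreserving : ∀ {n} {f : Vec Bool n → Bool} → Has C f → ZeroPreserving f) where

    open ZeroPreservingClone C rc zeroPreserving

    bounded⇒𝕋₀∞ : (∀ {n} {f : Vec Bool (suc n) → Bool} → Has C f → Bounded f) → 𝓒 K ≐ 𝕋₀∞
    bounded⇒𝕋₀∞ bounded = (λ h → bounded∈∞ (bounded h)) , (λ h → bounded∈ (𝕋₀∞-bounded h))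
      where
      C∞ = termClone K∞
      open ZeroPreservingClone C∞
        (relativelyComplete C∞ (nonimplies-relative C∞ (connective∈termClone K∞ zero)))
        (λ h → bounded-zeroPreserving (𝕋₀∞-bounded h)) renaming (bounded∈ to bounded∈∞)

    -- The covering argument runs inside `𝕋₀ (suc k)` rather than `C`; the converse only needs the
    -- two generators in `C`.
    intersecting⇒𝕋₀ : ∀ k → (∀ {n} {f : Vec Bool (suc n) → Bool} → Has C f → Intersecting (suc k) f) →
                      Has C (threshold (suc (suc k)) (suc k)) → 𝓒 K ≐ 𝕋₀ (suc k)
    intersecting⇒𝕋₀ k intersecting hθ =
      (λ h → intersecting∈ C₀
        (relativelyComplete C₀ (nonimplies-relative C₀ (connective∈termClone (K₀ (suc k)) (suc zero))))
        𝕋₀-zeroPreserving (connective∈termClone (K₀ (suc k)) zero) em (intersecting h)) ,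
      termClone⊆ (K₀ (suc k)) C (λ { zero → hθ ; (suc zero) → nonimplies∈ })
      where
      C₀ = termClone (K₀ (suc k))

    AllIntersecting : ℕ → Set
    AllIntersecting k = ∀ {n} {f : Vec Bool (suc n) → Bool} → Has C f → Intersecting k f

    Disjoint : ℕ → Set
    Disjoint k = ∃ λ n → ∃ λ (f : Vec Bool (suc n) → Bool) → Has C f ×
      ∃ λ (ps : Vec (Vec Bool (suc n)) k) → All (λ p → f p ≡ true) ps ×
      ¬ (∃ λ i → All (λ p → lookup p i ≡ true) ps)

    ¬disjoint⇒intersecting : ∀ {k} → ¬ Disjoint k → AllIntersecting k
    ¬disjoint⇒intersecting none {f = f} hf ps fps with em {P = ∃ λ i → All (λ p → lookup p i ≡ true) ps}
    ... | yes meet     = meet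
    ... | no  disjoint = ⊥-elim (none (_ , f , hf , ps , fps , disjoint))

    ¬disjoint-1 : ¬ Disjoint 1
    ¬disjoint-1 (n , f , hf , p ∷ [] , fp ∷ [] , disjoint) = false≢true (trans (sym (zeroPreserving hf))
      (trans (cong f (sym p≡0)) fp))
      where
      p-false : ∀ i → lookup p i ≡ false
      p-false i with lookup p i in e
      ... | false = refl
      ... | true  = ⊥-elim (disjoint (i , e ∷ []))
      p≡0 : p ≡ replicate (suc n) false
      p≡0 = trans (sym (tabulate∘lookup p)) (trans (tabulate-cong p-false) (replicate-tabulate (suc n) false))

    -- A descent in the number of points, which stops at the latest because `¬disjoint-1` excludes
    -- size 1.
    threshold-step : ∀ k → Disjoint (suc k) → ∃ λ k → ¬ Disjoint (suc k) × Disjoint (suc (suc k))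
    threshold-step zero    d = ⊥-elim (¬disjoint-1 d)
    threshold-step (suc k) d with em {P = Disjoint (suc k)}
    ... | yes d′ = threshold-step k d′
    ... | no ¬d′ = k , ¬d′ , d

    -- For each coordinate take a point where `f` is 1 that vanishes there.
    unbounded⇒disjoint : {f : Vec Bool (suc n) → Bool} → Has C f → ¬ Bounded f → Disjoint (suc n)
    unbounded⇒disjoint {n} {f} hf unbounded =
      n , f , hf , tabulate point , tabulate⁺ (λ i → proj₁ (proj₂ (avoiding i))) ,
      λ { (i , all-i) → false≢true (trans (sym (proj₂ (proj₂ (avoiding i)))) (tabulate⁻ {f = point} all-i i)) }
      where
      avoiding : ∀ i → ∃ λ p → f p ≡ true × lookup p i ≡ false
      avoiding i with em {P = ∃ λ p → f p ≡ true × lookup p i ≡ false}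
      ... | yes found = found
      ... | no  none  = ⊥-elim (unbounded (i , λ p fp → by-cases p fp _ refl))
        where
        by-cases : ∀ p → f p ≡ true → ∀ b → lookup p i ≡ b → lookup p i ≡ true
        by-cases p fp true  e = e
        by-cases p fp false e = ⊥-elim (none (p , fp , e))
      point : Fin (suc n) → Vec Bool (suc n)
      point i = proj₁ (avoiding i)

    zeroPreserving-listed : CloneListed K
    zeroPreserving-listed with em {P = ∃ λ n → ∃ λ (f : Vec Bool (suc n) → Bool) → Has C f × ¬ Bounded f}
    ... | no none = inj₂ (inj₁ (bounded⇒𝕋₀∞ bounded))
      where
      bounded : {f : Vec Bool (suc n) → Bool} → Has C f → Bounded f
      bounded {f = f} hf with em {P = Bounded f}
      ... | yes b  = b
      ... | no  ¬b = ⊥-elim (none (_ , f , hf , ¬b))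
    ... | yes (n , f , hf , ¬b) with threshold-step n (unbounded⇒disjoint hf ¬b)
    ...   | k , ¬d , (_ , _ , hg , ps , gps , disjoint) = inj₂ (inj₂ (suc k ,
      intersecting⇒𝕋₀ k (¬disjoint⇒intersecting ¬d)
        (threshold∈ C rc zeroPreserving hg ps gps disjoint)))

  cloneListed : CloneListed K
  cloneListed with em {P = ∃ λ n → ∃ λ (f : Vec Bool n → Bool) → Has C f × f (replicate n false) ≡ true}
  ... | yes (_ , _ , hf , f0) = inj₁ (negation⇒𝔻 (not-zeroPreserving⇒negation hf f0))
  ... | no  none              = zeroPreserving-listed λ {n} {f} hf → by-cases hf _ refl
    where
    by-cases : {f : Vec Bool n → Bool} → Has C f → ∀ b → f (replicate n false) ≡ b → ZeroPreserving f
    by-cases hf false e = e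
    by-cases hf true  e = ⊥-elim (none (_ , _ , hf , e))

-- The dichotomy

module _ {K₁ K₂ : Connectives} (topLike : ∀ c → TopLike K₂ c) where

  private
    Σ₁ = signature K₁
    Σ₂ = signature K₂
    K  = K₁ ⊎ᶜ K₂

  module _ {V W : Set} (top : Symbol Σ₂ → Formula Σ₁ W) (r : V → W) where

    -- The term `top c` stands in for the constant 1, and `r` renames variables so that one may be
    -- kept free for it.
    eraseAlg : (c : Symbol (Σ₁ ⊕ Σ₂)) → Vec (Formula Σ₁ W) (arity (Σ₁ ⊕ Σ₂) c) → Formula Σ₁ W
    eraseAlg (inj₁ c) ts = con c ts
    eraseAlg (inj₂ c) ts = top c

    erase : Formula (Σ₁ ⊕ Σ₂) V → Formula Σ₁ W
    erase = extend eraseAlg (var ∘ r)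

    erase-value : {ρ : V → Bool} {η : W → Bool} → (∀ c → extend ⟦ K₁ ⟧ η (top c) ≡ true) →
                  (∀ i → η (r i) ≡ ρ i) → ∀ φ → extend ⟦ K₁ ⟧ η (erase φ) ≡ extend ⟦ K ⟧ ρ φ
    erase-value {η = η} top-true base = extend-fusion (extend ⟦ K₁ ⟧ η)
      (λ { (inj₁ c) ts → cong (⟦ K₁ ⟧ c) (extends≡map _ _ ts)
         ; (inj₂ c) ts → trans (top-true c) (sym (topLike c _)) }) base

  module _ (complete : FunctionallyComplete K) where

    topLike⇒relativelyComplete : RelativelyComplete (termClone K₁)
    topLike⇒relativelyComplete {n} g with complete (n , g)
    ... | φ , φ≗g = _ , (erase (λ _ → var zero) suc φ , λ xs → refl) ,
      λ xs → trans (erase-value (λ _ → var zero) suc (λ _ → refl) (λ _ → refl) φ) (φ≗g xs)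

    -- Without symbols in `K₂`, terms over the union would already be terms over `K₁`.
    nonempty : (∀ {ℓ} → ExcludedMiddle ℓ) → ¬ FunctionallyComplete K₁ → Symbol Σ₂
    nonempty em incomplete with em {P = Symbol Σ₂}
    ... | yes c    = c
    ... | no empty = ⊥-elim (incomplete λ f → erase (⊥-elim ∘ empty) id (proj₁ (complete f)) ,
      λ xs → trans (erase-value (⊥-elim ∘ empty) id (λ c → ⊥-elim (empty c)) (λ _ → refl) (proj₁ (complete f)))
        (proj₂ (complete f) xs))

  formsUP₁ : Symbol Σ₂ → FormsUP₁ K₂
  formsUP₁ c₀ = ((λ { (φ , φ≗f) → resp C⊤ φ≗f (⊆-𝕌ℙ₁ φ) }) ,
                 (λ { (φ , φ≗f) → resp C₂ φ≗f (𝕌ℙ₁-⊆ φ) })) , topLike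
    where
    K⊤ = ⟨ (0 , λ _ → true) ∷ [] ⟩
    C⊤ = termClone K⊤
    C₂ = termClone K₂
    ⊆-𝕌ℙ₁ : (φ : Formula Σ₂ (Fin n)) → Has C⊤ (termFunction K₂ φ)
    ⊆-𝕌ℙ₁ (var i)    = proj C⊤ i
    ⊆-𝕌ℙ₁ (con c ts) = con zero [] , λ xs → sym (topLike c _)
    𝕌ℙ₁-⊆ : (φ : Formula (signature K⊤) (Fin (suc n))) → Has C₂ (termFunction K⊤ φ)
    𝕌ℙ₁-⊆ (var i)       = proj C₂ i
    𝕌ℙ₁-⊆ (con zero []) = con c₀ (replicate _ (var zero)) , λ xs → topLike c₀ _

constant-unless : (f : Vec Bool n → Bool) → (∀ m as → n ≡ suc m → f as ≢ false) →
                  ∀ as bs → f as ≡ f bs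
constant-unless {zero}  f _    []  []  = refl
constant-unless {suc n} f true! as bs with f as in e | f bs in e′
... | false | _     = ⊥-elim (true! n as refl e)
... | true  | false = ⊥-elim (true! n bs refl e′)
... | true  | true  = refl

module _ (em : ∀ {ℓ} → ExcludedMiddle ℓ) where

  module _ (K₁ K₂ : Connectives) where

    private
      Σ₂ = signature K₂

    topLike-or-meets : FunctionallyComplete (K₁ ⊎ᶜ K₂) → Classical K₁ K₂ →
                       (∀ c → TopLike K₂ c) ⊎ (∀ c → PreservesMeets (⟦ K₁ ⟧ c))
    topLike-or-meets complete classical
      with em {P = ∃ λ c → ∃ λ m → ∃ λ as → arity Σ₂ c ≡ suc m × ⟦ K₂ ⟧ c as ≡ false}
    ... | yes (c₂ , m , as , positive , false-at-as) =
      inj₂ λ c₁ xs ys → preserves-meet complete classical {c₁} {xs} {ys} positive false-at-as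
    ... | no none = inj₁ (constant⇒topLike complete classical λ c →
      constant-unless (⟦ K₂ ⟧ c) λ m as positive e → none (c , m , as , positive , e))

    listed-and-UP₁ : ¬ FunctionallyComplete K₁ → FunctionallyComplete (K₁ ⊎ᶜ K₂) →
                     (∀ c → TopLike K₂ c) → CloneListed K₁ × FormsUP₁ K₂
    listed-and-UP₁ incomplete complete topLike =
      cloneListed em K₁ (topLike⇒relativelyComplete topLike complete) incomplete ,
      formsUP₁ {K₁} topLike (nonempty {K₁} {K₂} topLike complete em incomplete)

    -- A term of `K₂` for the unary constant 1 cannot be a variable, so its head is the symbol from
    -- which `⊤₀` is built.
    UP₁⇒classical : FormsUP₁ K₂ → Classical K₁ K₂
    UP₁⇒classical ((_ , ⊆K₂) , topLike) with ⊆K₂ {0 , λ _ → true} (con zero [] , λ _ → refl)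
    ... | con c _ , _ = TopLikeRight.classical K₁ K₂ topLike em c
    ... | var zero , e = ⊥-elim (false≢true (e (false ∷ [])))

  -- Meet-preserving functions form a clone, and negation is outside it, as the points 1 and 0 show.
  not-all-meets : ∀ K₁ K₂ → FunctionallyComplete (K₁ ⊎ᶜ K₂) →
                  (∀ c → PreservesMeets (⟦ K₁ ⟧ c)) → ¬ (∀ c → PreservesMeets (⟦ K₂ ⟧ c))
  not-all-meets K₁ K₂ complete meets₁ meets₂ = false≢true (sym (termClone⊆ (K₁ ⊎ᶜ K₂) meetClone
    (λ { (inj₁ c) → meets₁ c ; (inj₂ c) → meets₂ c }) (complete (0 , negation)) (true ∷ []) (false ∷ [])))

  topLike-dichotomy : ∀ K₁ K₂ → FunctionallyComplete (K₁ ⊎ᶜ K₂) → Classical K₁ K₂ →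
                      (∀ c → TopLike K₂ c) ⊎ (∀ c → TopLike K₁ c)
  topLike-dichotomy K₁ K₂ complete classical
    with topLike-or-meets K₁ K₂ complete classical
       | topLike-or-meets K₂ K₁ (functionallyComplete-swap K₁ K₂ complete) (classical-swap K₁ K₂ classical)
  ... | inj₁ topLike₂ | _             = inj₁ topLike₂
  ... | inj₂ _        | inj₁ topLike₁ = inj₂ topLike₁
  ... | inj₂ meets₁   | inj₂ meets₂   = ⊥-elim (not-all-meets K₁ K₂ complete meets₁ meets₂)

theorem3 : (∀ {ℓ} → ExcludedMiddle ℓ) →
    (K₁ K₂ : Connectives) →
    ¬ FunctionallyComplete K₁ →
    ¬ FunctionallyComplete K₂ →
    FunctionallyComplete (K₁ ⊎ᶜ K₂) →
    (𝓑 K₁ • 𝓑 K₂ ≈ 𝓑 (K₁ ⊎ᶜ K₂)) ⇔ ((CloneListed K₁ × FormsUP₁ K₂) ⊎ (CloneListed K₂ × FormsUP₁ K₁))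
theorem3 em K₁ K₂ incomplete₁ incomplete₂ complete = mk⇔
  (λ classical → Sum.map (listed-and-UP₁ em K₁ K₂ incomplete₁ complete)
     (listed-and-UP₁ em K₂ K₁ incomplete₂ (functionallyComplete-swap K₁ K₂ complete))
     (topLike-dichotomy em K₁ K₂ complete classical))
  [ (λ { (_ , UP₁) → UP₁⇒classical em K₁ K₂ UP₁ })
  , (λ { (_ , UP₁) → classical-swap K₂ K₁ (UP₁⇒classical em K₂ K₁ UP₁) }) ]
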